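{- Let $a\geq 7$ be an integer, let $\rho$ be the root greater than $a+1$ of $x^3-ax^2-(a+3)x-1$, and let $\gamma=a^2+a+8+(a^2-a+1)\rho+(2-a)\rho^2\in\mathbb{Z}[\rho]$. Let $\varepsilon$ be a totally positive unit in $\mathbb{Z}[\rho]$. If $\gamma\succeq\varepsilon$, then $\varepsilon\in\{1,\rho^2\}$.
   Context: The polynomial $x^3-ax^2-(a+3)x-1$ is irreducible over $\mathbb{Q}$ with three real roots $\rho,\rho',\rho''$, labelled so that $a+1<\rho$, $-2<\rho'<-1$, $-1<\rho''<0$. The field $K=\mathbb{Q}(\rho)$ is cyclic cubic; for $\alpha\in K$, $\alpha'$ and $\alpha''$ denote the images of $\alpha$ under the $\mathbb{Q}$-isomorphisms given by $\rho\mapsto\rho'$ and $\rho\mapsto\rho''$ respectively. An element $\alpha$ is totally positive if $\alpha,\alpha',\alpha''>0$. For totally positive $\alpha,\beta\in\mathbb{Z}[\rho]$, $\alpha\succ\beta$ means $\alpha>\beta$, $\alpha'>\beta'$ and $\alpha''>\beta''$; $\alpha\succeq\beta$ means $\alpha\succ\beta$ or $\alpha=\beta$. -}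

module Defs where

open import Algebra.Definitions using (Invertible)
open import Data.Integer as ℤ using (ℤ)
open import Data.Nat as ℕ using (ℕ)
import Data.Nat.Properties as ℕ
open import Data.Product using (∃-syntax; _×_; _,_)
open import Data.Rational using (ℚ; 0ℚ; 1ℚ; ½; _+_; _*_; -_; _-_; _<_; _≤_; ∣_∣; 1/_; _/_; Positive; NonZero; positive; nonNegative)
open import Data.Rational.Properties
open import Data.Sum using (_⊎_)
open import Relation.Binary.PropositionalEquality using (_≡_; refl; sym; trans; cong; cong₂; subst)
open import Relation.Nullary.Decidable.Core using (dec⇒maybe)
open import Tactic.RingSolver using (solve-∀)
open import Tactic.RingSolver.Core.AlmostCommutativeRing using (AlmostCommutativeRing; fromCommutativeRing)

private
  ℚ-ring : AlmostCommutativeRing _ _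
  ℚ-ring = fromCommutativeRing +-*-commutativeRing (λ p → dec⇒maybe (0ℚ ≟ p))

IsCauchy : (ℕ → ℚ) → Set
IsCauchy s = ∀ δ → 0ℚ < δ → ∃[ N ] (∀ m n → N ℕ.≤ m → N ℕ.≤ n → ∣ s m - s n ∣ < δ)

-- Real numbers as Cauchy sequences of rationals; equality is _≈ℝ_, not _≡_.
record ℝ : Set where
  constructor mkℝ
  field
    seq      : ℕ → ℚ
    isCauchy : IsCauchy seq

open ℝ public

infix 4 _≈ℝ_ _<ℝ_

_≈ℝ_ : ℝ → ℝ → Set
x ≈ℝ y = ∀ δ → 0ℚ < δ → ∃[ N ] (∀ n → N ℕ.≤ n → ∣ seq x n - seq y n ∣ < δ)

-- The uniform gap δ is what makes this strict: termwise _<_ would also hold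
-- between sequences with the same limit.
_<ℝ_ : ℝ → ℝ → Set
x <ℝ y = ∃[ δ ] (0ℚ < δ × ∃[ N ] (∀ n → N ℕ.≤ n → seq x n + δ < seq y n))

private abstract
  half-pos : ∀ {δ} → 0ℚ < δ → 0ℚ < ½ * δ
  half-pos {δ} δ>0 = positive⁻¹ (½ * δ) {{pos*pos⇒pos ½ δ {{positive δ>0}}}}

  halves : ∀ δ → ½ * δ + ½ * δ ≡ δ
  halves δ = trans (sym (*-distribʳ-+ δ ½ ½)) (trans (cong (_* δ) ½+½) (*-identityˡ δ))
    where
    ½+½ : ½ + ½ ≡ 1ℚ
    ½+½ = refl

  const-isCauchy : ∀ q → IsCauchy (λ _ → q)
  const-isCauchy q δ δ>0 = 0 , λ _ _ _ _ → subst (λ t → ∣ t ∣ < δ) (sym (+-inverseʳ q)) δ>0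

  +-isCauchy : ∀ s t → IsCauchy s → IsCauchy t → IsCauchy (λ n → s n + t n)
  +-isCauchy s t cs ct δ δ>0
    with cs (½ * δ) (half-pos δ>0) | ct (½ * δ) (half-pos δ>0)
  ... | M , hs | N , ht = M ℕ.⊔ N , λ m n m≥ n≥ → begin-strict
    ∣ (s m + t m) - (s n + t n) ∣      ≡⟨ cong ∣_∣ (regroup (s m) (t m) (s n) (t n)) ⟩
    ∣ (s m - s n) + (t m - t n) ∣      ≤⟨ ∣p+q∣≤∣p∣+∣q∣ (s m - s n) (t m - t n) ⟩
    ∣ s m - s n ∣ + ∣ t m - t n ∣      <⟨ +-mono-< (hs m n (ℕ.m⊔n≤o⇒m≤o M N m≥) (ℕ.m⊔n≤o⇒m≤o M N n≥))
                                                   (ht m n (ℕ.m⊔n≤o⇒n≤o M N m≥) (ℕ.m⊔n≤o⇒n≤o M N n≥)) ⟩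
    ½ * δ + ½ * δ                      ≡⟨ halves δ ⟩
    δ                                  ∎
    where
    open ≤-Reasoning
    regroup : ∀ a b c d → (a + b) - (c + d) ≡ (a - c) + (b - d)
    regroup = solve-∀ ℚ-ring

  eventuallyBounded : ∀ {s} → IsCauchy s → ∃[ B ] (0ℚ < B × ∃[ N ] (∀ n → N ℕ.≤ n → ∣ s n ∣ ≤ B))
  eventuallyBounded {s} cs with cs 1ℚ (positive⁻¹ 1ℚ)
  ... | N , h = 1ℚ + ∣ s N ∣ , B>0 , N , λ n n≥ → begin
    ∣ s n ∣                    ≡⟨ cong ∣_∣ (split (s n) (s N)) ⟩
    ∣ (s n - s N) + s N ∣      ≤⟨ ∣p+q∣≤∣p∣+∣q∣ (s n - s N) (s N) ⟩
    ∣ s n - s N ∣ + ∣ s N ∣    ≤⟨ +-monoˡ-≤ ∣ s N ∣ (<⇒≤ (h n N n≥ ℕ.≤-refl)) ⟩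
    1ℚ + ∣ s N ∣               ∎
    where
    open ≤-Reasoning
    split : ∀ a b → a ≡ (a - b) + b
    split = solve-∀ ℚ-ring
    B>0 : 0ℚ < 1ℚ + ∣ s N ∣
    B>0 = +-mono-<-≤ (positive⁻¹ 1ℚ) (0≤∣p∣ (s N))

  -- For B > 0 and δ > 0 there is η > 0 with B η = δ.
  quotient : ∀ {B δ} → 0ℚ < B → 0ℚ < δ → ∃[ η ] (0ℚ < η × B * η ≡ δ)
  quotient {B} {δ} B>0 δ>0 = 1/B * δ , η>0 , eq
    where
    instance
      posB : Positive B
      posB = positive B>0
      nzB : NonZero B
      nzB = pos⇒nonZero B
    1/B : ℚ
    1/B = 1/ B
    η>0 : 0ℚ < 1/B * δ
    η>0 = positive⁻¹ (1/B * δ) {{pos*pos⇒pos 1/B {{1/pos⇒pos B}} δ {{positive δ>0}}}}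
    eq : B * (1/B * δ) ≡ δ
    eq = trans (sym (*-assoc B 1/B δ)) (trans (cong (_* δ) (*-inverseʳ B)) (*-identityˡ δ))

  ∣*∣< : ∀ {p q B η} → 0ℚ < B → ∣ p ∣ ≤ B → ∣ q ∣ < η → ∣ p * q ∣ < B * η
  ∣*∣< {p} {q} {B} {η} B>0 p≤ q< = begin-strict
    ∣ p * q ∣       ≡⟨ ∣p*q∣≡∣p∣*∣q∣ p q ⟩
    ∣ p ∣ * ∣ q ∣   ≤⟨ *-monoʳ-≤-nonNeg ∣ q ∣ {{nonNegative (0≤∣p∣ q)}} p≤ ⟩
    B * ∣ q ∣       <⟨ *-monoʳ-<-pos B {{positive B>0}} q< ⟩
    B * η           ∎
    where open ≤-Reasoning

  product-close : ∀ {B C η θ δ} → 0ℚ < B → 0ℚ < C → B * η ≡ ½ * δ → C * θ ≡ ½ * δ →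
    ∀ p q p′ q′ → ∣ p ∣ ≤ B → ∣ q′ ∣ ≤ C → ∣ q - q′ ∣ < η → ∣ p - p′ ∣ < θ →
    ∣ p * q - p′ * q′ ∣ < δ
  product-close {B} {C} {η} {θ} {δ} B>0 C>0 Bη Cθ p q p′ q′ p≤ q′≤ Δq Δp = begin-strict
    ∣ p * q - p′ * q′ ∣                          ≡⟨ cong ∣_∣ (regroup p q p′ q′) ⟩
    ∣ p * (q - q′) + q′ * (p - p′) ∣             ≤⟨ ∣p+q∣≤∣p∣+∣q∣ (p * (q - q′)) (q′ * (p - p′)) ⟩
    ∣ p * (q - q′) ∣ + ∣ q′ * (p - p′) ∣         <⟨ +-mono-< (∣*∣< {p} {q - q′} B>0 p≤ Δq) (∣*∣< {q′} {p - p′} C>0 q′≤ Δp) ⟩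
    B * η + C * θ                                ≡⟨ cong₂ _+_ Bη Cθ ⟩
    ½ * δ + ½ * δ                                ≡⟨ halves δ ⟩
    δ                                            ∎
    where
    open ≤-Reasoning
    regroup : ∀ a b c d → a * b - c * d ≡ a * (b - d) + d * (a - c)
    regroup = solve-∀ ℚ-ring

  *-isCauchy : ∀ s t → IsCauchy s → IsCauchy t → IsCauchy (λ n → s n * t n)
  *-isCauchy s t cs ct δ δ>0 =
    let B , B>0 , K , hB = eventuallyBounded {s} cs
        C , C>0 , L , hC = eventuallyBounded {t} ct
        η , η>0 , Bη     = quotient {B} {½ * δ} B>0 (half-pos δ>0)
        θ , θ>0 , Cθ     = quotient {C} {½ * δ} C>0 (half-pos δ>0)
        M , ht           = ct η η>0
        N , hs           = cs θ θ>0
    in (K ℕ.⊔ L) ℕ.⊔ (M ℕ.⊔ N) , λ m n m≥ n≥ →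
      let m≥KL = ℕ.m⊔n≤o⇒m≤o (K ℕ.⊔ L) (M ℕ.⊔ N) m≥
          n≥KL = ℕ.m⊔n≤o⇒m≤o (K ℕ.⊔ L) (M ℕ.⊔ N) n≥
          m≥MN = ℕ.m⊔n≤o⇒n≤o (K ℕ.⊔ L) (M ℕ.⊔ N) m≥
          n≥MN = ℕ.m⊔n≤o⇒n≤o (K ℕ.⊔ L) (M ℕ.⊔ N) n≥
      in product-close B>0 C>0 Bη Cθ (s m) (t m) (s n) (t n)
           (hB m (ℕ.m⊔n≤o⇒m≤o K L m≥KL)) (hC n (ℕ.m⊔n≤o⇒n≤o K L n≥KL))
           (ht m n (ℕ.m⊔n≤o⇒m≤o M N m≥MN) (ℕ.m⊔n≤o⇒m≤o M N n≥MN))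
           (hs m n (ℕ.m⊔n≤o⇒n≤o M N m≥MN) (ℕ.m⊔n≤o⇒n≤o M N n≥MN))

fromℤ : ℤ → ℝ
fromℤ k = mkℝ (λ _ → k / 1) (const-isCauchy (k / 1))

infixl 6 _+ℝ_ _-ℝ_
infixl 7 _*ℝ_

_+ℝ_ : ℝ → ℝ → ℝ
x +ℝ y = mkℝ (λ n → seq x n + seq y n) (+-isCauchy (seq x) (seq y) (isCauchy x) (isCauchy y))

_*ℝ_ : ℝ → ℝ → ℝ
x *ℝ y = mkℝ (λ n → seq x n * seq y n) (*-isCauchy (seq x) (seq y) (isCauchy x) (isCauchy y))

_-ℝ_ : ℝ → ℝ → ℝ
x -ℝ y = x +ℝ fromℤ (ℤ.- ℤ.+ 1) *ℝ y

f : ℤ → ℝ → ℝ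
f a x = x *ℝ x *ℝ x -ℝ fromℤ a *ℝ (x *ℝ x) -ℝ fromℤ (a ℤ.+ ℤ.+ 3) *ℝ x -ℝ fromℤ (ℤ.+ 1)

record Roots (a : ℤ) : Set where
  field
    ρ ρ′ ρ″   : ℝ
    ρ-root    : f a ρ  ≈ℝ fromℤ (ℤ.+ 0)
    ρ′-root   : f a ρ′ ≈ℝ fromℤ (ℤ.+ 0)
    ρ″-root   : f a ρ″ ≈ℝ fromℤ (ℤ.+ 0)
    a+1<ρ     : fromℤ (a ℤ.+ ℤ.+ 1) <ℝ ρ
    -2<ρ′     : fromℤ (ℤ.- ℤ.+ 2) <ℝ ρ′
    ρ′<-1     : ρ′ <ℝ fromℤ (ℤ.- ℤ.+ 1)
    -1<ρ″     : fromℤ (ℤ.- ℤ.+ 1) <ℝ ρ″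
    ρ″<0      : ρ″ <ℝ fromℤ (ℤ.+ 0)

-- ℤ[ρ] ≅ ℤ[x]/(x³ - a x² - (a + 3) x - 1): ⟨ u , v , w ⟩ is u + v ρ + w ρ².
-- As the polynomial is irreducible over ℚ, 1, ρ, ρ² is a ℤ-basis, so _≡_ is
-- the equality of ℤ[ρ].
record ℤ[ρ] (a : ℤ) : Set where
  constructor ⟨_,_,_⟩
  field
    c₀ c₁ c₂ : ℤ

module _ {a : ℤ} where

  infixl 6 _⊕_
  infixl 7 _⊗_ _•_

  1ρ : ℤ[ρ] a
  1ρ = ⟨ ℤ.+ 1 , ℤ.+ 0 , ℤ.+ 0 ⟩

  gen : ℤ[ρ] a
  gen = ⟨ ℤ.+ 0 , ℤ.+ 1 , ℤ.+ 0 ⟩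

  _⊕_ : ℤ[ρ] a → ℤ[ρ] a → ℤ[ρ] a
  ⟨ u , v , w ⟩ ⊕ ⟨ x , y , z ⟩ = ⟨ u ℤ.+ x , v ℤ.+ y , w ℤ.+ z ⟩

  _•_ : ℤ → ℤ[ρ] a → ℤ[ρ] a
  k • ⟨ x , y , z ⟩ = ⟨ k ℤ.* x , k ℤ.* y , k ℤ.* z ⟩

  -- Multiplication by ρ, using ρ³ = 1 + (a + 3) ρ + a ρ².
  ρ·_ : ℤ[ρ] a → ℤ[ρ] a
  ρ· ⟨ x , y , z ⟩ = ⟨ z , x ℤ.+ (a ℤ.+ ℤ.+ 3) ℤ.* z , y ℤ.+ a ℤ.* z ⟩

  _⊗_ : ℤ[ρ] a → ℤ[ρ] a → ℤ[ρ] a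
  ⟨ u , v , w ⟩ ⊗ β = u • β ⊕ v • (ρ· β) ⊕ w • (ρ· (ρ· β))

  IsUnit : ℤ[ρ] a → Set
  IsUnit = Invertible _≡_ 1ρ _⊗_

  -- The image of an element under the embedding ρ ↦ r into ℝ.
  ⟦_⟧ : ℤ[ρ] a → ℝ → ℝ
  ⟦ ⟨ u , v , w ⟩ ⟧ r = fromℤ u +ℝ fromℤ v *ℝ r +ℝ fromℤ w *ℝ (r *ℝ r)

  module Conjugates (R : Roots a) where
    open Roots R

    infix 4 _≻_ _⪰_

    TotallyPositive : ℤ[ρ] a → Set
    TotallyPositive α = fromℤ (ℤ.+ 0) <ℝ ⟦ α ⟧ ρ × fromℤ (ℤ.+ 0) <ℝ ⟦ α ⟧ ρ′ × fromℤ (ℤ.+ 0) <ℝ ⟦ α ⟧ ρ″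

    _≻_ : ℤ[ρ] a → ℤ[ρ] a → Set
    α ≻ β = ⟦ β ⟧ ρ <ℝ ⟦ α ⟧ ρ × ⟦ β ⟧ ρ′ <ℝ ⟦ α ⟧ ρ′ × ⟦ β ⟧ ρ″ <ℝ ⟦ α ⟧ ρ″

    _⪰_ : ℤ[ρ] a → ℤ[ρ] a → Set
    α ⪰ β = α ≻ β ⊎ α ≡ β

γ : (a : ℤ) → ℤ[ρ] a
γ a = ⟨ a ℤ.* a ℤ.+ a ℤ.+ ℤ.+ 8 , a ℤ.* a ℤ.- a ℤ.+ ℤ.+ 1 , ℤ.+ 2 ℤ.- a ⟩

{-# OPTIONS --safe #-}
module Submission where

-- Put t = 1/ρ and s = 1/(1 + ρ). Then ρ′ = -1 - t, ρ″ = -s and ρ = a + 1 + s + t, so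
-- ε = i + j (1 + ρ) + k ρ′ with i, j, k ∈ ℤ has the conjugates
--   x = i + j (1 + ρ) - k (1 + t),  y = i - j t - k s,  z = i + j (1 - s) + k ρ,
-- and γ is the element with (i, j, k) = (11, a + 1, a - 2). Positivity of x, y, z and the
-- bounds given by γ confine (i, j, k); a unit has x y z = 1, whereas in the remaining range
-- x y z factors into three terms that exceed 1, except at (1, 0, 0) and (2, a, -1), that
-- is, at 1 and ρ². All inequalities are between elements of ℤ[ρ], ordered by the embedding
-- in ℝ, and each follows from an identity that exhibits a difference as a combination with
-- nonnegative coefficients of products of s, t, ρ, b = a - 7 and integers known to be
-- nonnegative.

open import Defs
open import Algebra.Bundles using (CommutativeSemigroup)
import Algebra.Properties.CommutativeSemigroup as CommutativeSemigroupProperties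
open import Data.Bool using (Bool; true; false; _∧_; _∨_)
open import Data.Empty using (⊥; ⊥-elim)
open import Data.Fin using (Fin; zero; suc; #_)
open import Data.Integer as ℤ using (ℤ)
import Data.Integer.Properties as ℤ
open import Data.Integer.Solver using (module +-*-Solver)
open import Data.Nat as ℕ using (ℕ; suc; zero; s≤s; z≤n)
import Data.Nat.Properties as ℕ
open import Data.Product using (∃-syntax; _×_; _,_; proj₁; proj₂)
open import Data.Sum using (_⊎_; inj₁; inj₂)
open import Data.Vec using (Vec; _∷_; [])
open import Relation.Binary.PropositionalEquality hiding (J)
open import Relation.Nullary using (¬_)
open import Relation.Nullary.Decidable using (from-yes)
open import Relation.Nullary.Decidable.Core using (dec⇒maybe)
open import Tactic.RingSolver using (solve-∀)
open import Tactic.RingSolver.Core.AlmostCommutativeRing using (AlmostCommutativeRing; fromCommutativeRing)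
open +-*-Solver using (Polynomial; con; var; _:+_; _:*_; :-_; _:-_; Normal; normalise; correct; ⟦_⟧N; _+N_; _*N_; +N-homo; *N-homo; solve; _:=_)
  renaming (⟦_⟧ to ⟦_⟧P)

-- Rational sequences

module Sequences where

  open import Data.Rational using (ℚ; 0ℚ; 1ℚ; ½; _+_; _*_; -_; _-_; _<_; _≤_; ∣_∣; 1/_; _/_; Positive; NonZero; positive; nonNegative; toℚᵘ)
  open import Data.Rational.Properties
  import Data.Rational.Unnormalised as ℚᵘ
  import Data.Rational.Unnormalised.Properties as ℚᵘ

  ℚ-ring : AlmostCommutativeRing _ _
  ℚ-ring = fromCommutativeRing +-*-commutativeRing (λ p → dec⇒maybe (0ℚ ≟ p))

  Eventually : (ℕ → Set) → Set
  Eventually A = ∃[ N ] (∀ n → N ℕ.≤ n → A n)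

  module _ {A B : ℕ → Set} where

    eventually-map : (∀ n → A n → B n) → Eventually A → Eventually B
    eventually-map g (N , h) = N , λ n N≤n → g n (h n N≤n)

    eventually-zip : {C : ℕ → Set} → (∀ n → A n → B n → C n) → Eventually A → Eventually B → Eventually C
    eventually-zip g (M , h) (N , k) = M ℕ.⊔ N , λ n ≥ →
      g n (h n (ℕ.m⊔n≤o⇒m≤o M N ≥)) (k n (ℕ.m⊔n≤o⇒n≤o M N ≥))

  -- The uniform gap in `Pos` survives the addition of a `Null` sequence and division by a bounded
  -- positive one; both are used throughout.
  Pos Null Bounded : (ℕ → ℚ) → Set
  Pos s     = ∃[ δ ] (0ℚ < δ × Eventually (λ n → δ < s n))
  Null s    = ∀ δ → 0ℚ < δ → Eventually (λ n → ∣ s n ∣ < δ)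
  Bounded s = ∃[ B ] (0ℚ < B × Eventually (λ n → ∣ s n ∣ ≤ B))

  *-pos : ∀ {p r} → 0ℚ < p → 0ℚ < r → 0ℚ < p * r
  *-pos {p} {r} p>0 r>0 = positive⁻¹ (p * r) {{pos*pos⇒pos p {{positive p>0}} r {{positive r>0}}}}

  halves : ∀ δ → ½ * δ + ½ * δ ≡ δ
  halves δ = trans (sym (*-distribʳ-+ δ ½ ½)) (*-identityˡ δ)

  divide : ∀ {B δ} → 0ℚ < B → 0ℚ < δ → ∃[ η ] (0ℚ < η × η * B ≡ δ)
  divide {B} {δ} B>0 δ>0 = δ * 1/ B , *-pos δ>0 (positive⁻¹ (1/ B) {{1/pos⇒pos B}}) ,
    trans (*-assoc δ (1/ B) B) (trans (cong (δ *_) (*-inverseˡ B)) (*-identityʳ δ))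
    where
    instance
      B-positive : Positive B
      B-positive = positive B>0
      B-nonZero : NonZero B
      B-nonZero = pos⇒nonZero B

  p≤∣p∣ : ∀ p → p ≤ ∣ p ∣
  p≤∣p∣ p with ≤-total 0ℚ p
  ... | inj₁ 0≤p = ≤-reflexive (sym (0≤p⇒∣p∣≡p 0≤p))
  ... | inj₂ p≤0 = ≤-trans p≤0 (0≤∣p∣ p)

  cauchy⇒bounded : ∀ {s} → IsCauchy s → Bounded s
  cauchy⇒bounded {s} cs with cs 1ℚ (positive⁻¹ 1ℚ)
  ... | N , h = 1ℚ + ∣ s N ∣ , +-mono-<-≤ (positive⁻¹ 1ℚ) (0≤∣p∣ (s N)) , N , λ n N≤n → begin
    ∣ s n ∣                    ≡⟨ cong ∣_∣ (split (s n) (s N)) ⟩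
    ∣ (s n - s N) + s N ∣      ≤⟨ ∣p+q∣≤∣p∣+∣q∣ (s n - s N) (s N) ⟩
    ∣ s n - s N ∣ + ∣ s N ∣    ≤⟨ +-monoˡ-≤ ∣ s N ∣ (<⇒≤ (h n N N≤n ℕ.≤-refl)) ⟩
    1ℚ + ∣ s N ∣               ∎
    where
    open ≤-Reasoning
    split : ∀ p r → p ≡ (p - r) + r
    split = solve-∀ ℚ-ring

  null-neg : ∀ {s} → Null s → Null (λ n → - s n)
  null-neg {s} h δ δ>0 = eventually-map (λ n → subst (_< δ) (sym (∣-p∣≡∣p∣ (s n)))) (h δ δ>0)

  module _ {s t : ℕ → ℚ} where

    pos-ext : (∀ n → s n ≡ t n) → Pos s → Pos t
    pos-ext s≡t (δ , δ>0 , h) = δ , δ>0 , eventually-map (λ n → subst (δ <_) (s≡t n)) h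

    null-ext : (∀ n → s n ≡ t n) → Null s → Null t
    null-ext s≡t h δ δ>0 = eventually-map (λ n → subst (λ p → ∣ p ∣ < δ) (s≡t n)) (h δ δ>0)

    pos-+ : Pos s → Pos t → Pos (λ n → s n + t n)
    pos-+ (δ , δ>0 , h) (θ , θ>0 , k) =
      δ + θ , +-mono-< δ>0 θ>0 , eventually-zip (λ _ → +-mono-<) h k

    pos-* : Pos s → Pos t → Pos (λ n → s n * t n)
    pos-* (δ , δ>0 , h) (θ , θ>0 , k) = δ * θ , *-pos δ>0 θ>0 , eventually-zip product h k
      where
      open ≤-Reasoning
      product : ∀ n → δ < s n → θ < t n → δ * θ < s n * t n
      product n δ< θ< = begin-strict
        δ * θ      <⟨ *-monoʳ-<-pos δ {{positive δ>0}} θ< ⟩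
        δ * t n    <⟨ *-monoˡ-<-pos (t n) {{positive (<-trans θ>0 θ<)}} δ< ⟩
        s n * t n  ∎

    pos+null⇒pos : Pos s → Null t → Pos (λ n → s n + t n)
    pos+null⇒pos (δ , δ>0 , h) k = ½ * δ , ½δ>0 , eventually-zip close h (k (½ * δ) ½δ>0)
      where
      open ≤-Reasoning
      ½δ>0 : 0ℚ < ½ * δ
      ½δ>0 = *-pos (positive⁻¹ ½) δ>0
      cancel : ∀ p r → p ≡ (p + r) - r
      cancel = solve-∀ ℚ-ring
      close : ∀ n → δ < s n → ∣ t n ∣ < ½ * δ → ½ * δ < s n + t n
      close n δ< t< = begin-strict
        ½ * δ                    ≡⟨ cancel (½ * δ) (½ * δ) ⟩
        (½ * δ + ½ * δ) - ½ * δ  ≡⟨ cong (_- ½ * δ) (halves δ) ⟩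
        δ - ½ * δ                <⟨ +-mono-< δ< (neg-antimono-< t<) ⟩
        s n - ∣ t n ∣            ≡⟨ cong (λ p → s n - p) (∣-p∣≡∣p∣ (t n)) ⟨
        s n - ∣ - t n ∣          ≤⟨ +-monoʳ-≤ (s n) (neg-antimono-≤ (p≤∣p∣ (- t n))) ⟩
        s n - - t n              ≡⟨ cong (s n +_) (neg-involutive (t n)) ⟩
        s n + t n                ∎
        where
        neg-involutive : ∀ p → - - p ≡ p
        neg-involutive = solve-∀ ℚ-ring

    null-+ : Null s → Null t → Null (λ n → s n + t n)
    null-+ h k δ δ>0 = eventually-zip sum< (h (½ * δ) ½δ>0) (k (½ * δ) ½δ>0)
      where
      open ≤-Reasoning
      ½δ>0 : 0ℚ < ½ * δ
      ½δ>0 = *-pos (positive⁻¹ ½) δ>0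
      sum< : ∀ n → ∣ s n ∣ < ½ * δ → ∣ t n ∣ < ½ * δ → ∣ s n + t n ∣ < δ
      sum< n s< t< = begin-strict
        ∣ s n + t n ∣      ≤⟨ ∣p+q∣≤∣p∣+∣q∣ (s n) (t n) ⟩
        ∣ s n ∣ + ∣ t n ∣  <⟨ +-mono-< s< t< ⟩
        ½ * δ + ½ * δ      ≡⟨ halves δ ⟩
        δ                  ∎

    null*bounded⇒null : Null s → Bounded t → Null (λ n → s n * t n)
    null*bounded⇒null h (B , B>0 , k) δ δ>0 with divide B>0 δ>0
    ... | η , η>0 , ηB≡δ = eventually-zip product< (h η η>0) k
      where
      open ≤-Reasoning
      product< : ∀ n → ∣ s n ∣ < η → ∣ t n ∣ ≤ B → ∣ s n * t n ∣ < δ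
      product< n s< t≤ = begin-strict
        ∣ s n * t n ∣      ≡⟨ ∣p*q∣≡∣p∣*∣q∣ (s n) (t n) ⟩
        ∣ s n ∣ * ∣ t n ∣  ≤⟨ *-monoˡ-≤-nonNeg ∣ s n ∣ {{nonNegative (0≤∣p∣ (s n))}} t≤ ⟩
        ∣ s n ∣ * B        <⟨ *-monoˡ-<-pos B {{positive B>0}} s< ⟩
        η * B              ≡⟨ ηB≡δ ⟩
        δ                  ∎

    pos-cancelʳ : Bounded t → Pos t → Pos (λ n → s n * t n) → Pos s
    pos-cancelʳ (B , B>0 , h) (θ , θ>0 , k) (δ , δ>0 , l) with divide B>0 δ>0
    ... | η , η>0 , ηB≡δ = η , η>0 , eventually-zip (λ n → cancel n) h (eventually-zip (λ _ → _,_) k l)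
      where
      open ≤-Reasoning
      cancel : ∀ n → ∣ t n ∣ ≤ B → θ < t n × δ < s n * t n → η < s n
      cancel n t≤ (θ< , δ<) = *-cancelʳ-<-nonNeg (t n) {{nonNegative (<⇒≤ t>0)}} (begin-strict
        η * t n    ≤⟨ *-monoˡ-≤-nonNeg η {{nonNegative (<⇒≤ η>0)}} (≤-trans (p≤∣p∣ (t n)) t≤) ⟩
        η * B      ≡⟨ ηB≡δ ⟩
        δ          <⟨ δ< ⟩
        s n * t n  ∎)
        where
        t>0 : 0ℚ < t n
        t>0 = <-trans θ>0 θ<

    null-cancelʳ : Pos t → Null (λ n → s n * t n) → Null s
    null-cancelʳ (θ , θ>0 , h) k δ δ>0 = eventually-zip cancel h (k (δ * θ) (*-pos δ>0 θ>0))
      where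
      open ≤-Reasoning
      cancel : ∀ n → θ < t n → ∣ s n * t n ∣ < δ * θ → ∣ s n ∣ < δ
      cancel n θ< st< = *-cancelʳ-<-nonNeg (t n) {{nonNegative 0≤t}} (begin-strict
        ∣ s n ∣ * t n      ≡⟨ cong (∣ s n ∣ *_) (0≤p⇒∣p∣≡p 0≤t) ⟨
        ∣ s n ∣ * ∣ t n ∣  ≡⟨ ∣p*q∣≡∣p∣*∣q∣ (s n) (t n) ⟨
        ∣ s n * t n ∣      <⟨ st< ⟩
        δ * θ              <⟨ *-monoʳ-<-pos δ {{positive δ>0}} θ< ⟩
        δ * t n            ∎)
        where
        0≤t : 0ℚ ≤ t n
        0≤t = <⇒≤ (<-trans θ>0 θ<)

  ¬pos-0 : ¬ Pos (λ _ → 0ℚ)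
  ¬pos-0 (δ , δ>0 , N , h) = <-asym δ>0 (h N ℕ.≤-refl)

  <ℝ⇒pos : ∀ x y → x <ℝ y → Pos (λ n → seq y n - seq x n)
  <ℝ⇒pos x y (δ , δ>0 , h) = δ , δ>0 , eventually-map shift h
    where
    cancel : ∀ p r → (p + r) - p ≡ r
    cancel = solve-∀ ℚ-ring
    shift : ∀ n → seq x n + δ < seq y n → δ < seq y n - seq x n
    shift n lt = subst (_< seq y n - seq x n) (cancel (seq x n) δ) (+-monoˡ-< (- seq x n) lt)

  ≈0⇒null : ∀ x → x ≈ℝ fromℤ (ℤ.+ 0) → Null (seq x)
  ≈0⇒null x h = null-ext (λ n → +-identityʳ (seq x n)) h

  ι : ℤ → ℚ
  ι k = k / 1

  -- For a variable `k` the fraction `k / 1` is reduced by a gcd and does not compute, hence the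
  -- detour through unnormalised rationals, where only factors 1 remain.
  ι-+ : ∀ i j → ι (i ℤ.+ j) ≡ ι i + ι j
  ι-+ i j = toℚᵘ-injective (begin
    toℚᵘ (ι (i ℤ.+ j))                     ≈⟨ toℚᵘ-fromℚᵘ (ℚᵘ.mkℚᵘ (i ℤ.+ j) 0) ⟩
    ℚᵘ.mkℚᵘ (i ℤ.+ j) 0                    ≈⟨ ℚᵘ.*≡* (cong (ℤ._* ℤ.+ 1) (cong₂ ℤ._+_ (sym (ℤ.*-identityʳ i)) (sym (ℤ.*-identityʳ j)))) ⟩
    ℚᵘ.mkℚᵘ i 0 ℚᵘ.+ ℚᵘ.mkℚᵘ j 0           ≈⟨ ℚᵘ.+-cong (toℚᵘ-fromℚᵘ (ℚᵘ.mkℚᵘ i 0)) (toℚᵘ-fromℚᵘ (ℚᵘ.mkℚᵘ j 0)) ⟨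
    toℚᵘ (ι i) ℚᵘ.+ toℚᵘ (ι j)             ≈⟨ toℚᵘ-homo-+ (ι i) (ι j) ⟨
    toℚᵘ (ι i + ι j)                       ∎)
    where open ℚᵘ.≃-Reasoning

  ι-* : ∀ i j → ι (i ℤ.* j) ≡ ι i * ι j
  ι-* i j = toℚᵘ-injective (begin
    toℚᵘ (ι (i ℤ.* j))                     ≈⟨ toℚᵘ-fromℚᵘ (ℚᵘ.mkℚᵘ (i ℤ.* j) 0) ⟩
    ℚᵘ.mkℚᵘ i 0 ℚᵘ.* ℚᵘ.mkℚᵘ j 0           ≈⟨ ℚᵘ.*-cong (toℚᵘ-fromℚᵘ (ℚᵘ.mkℚᵘ i 0)) (toℚᵘ-fromℚᵘ (ℚᵘ.mkℚᵘ j 0)) ⟨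
    toℚᵘ (ι i) ℚᵘ.* toℚᵘ (ι j)             ≈⟨ toℚᵘ-homo-* (ι i) (ι j) ⟨
    toℚᵘ (ι i * ι j)                       ∎)
    where open ℚᵘ.≃-Reasoning

open Sequences

-- Evaluation of ℤ[ρ] at reals

module Evaluation {a : ℤ} where

  open import Data.Rational using (ℚ; 0ℚ; 1ℚ; _+_; _*_; -_; _-_; _/_)
  open import Data.Rational.Properties using (+-identityʳ)

  ev : ℤ[ρ] a → ℚ → ℚ
  ev ⟨ u , v , w ⟩ r = ι u + ι v * r + ι w * (r * r)

  -- Spelled with factors `- 1ℚ` so that `minpoly (seq r n)` is `seq (f a r) n` by computation.
  minpoly : ℚ → ℚ
  minpoly r = r * r * r + - 1ℚ * (ι a * (r * r)) + - 1ℚ * (ι (a ℤ.+ ℤ.+ 3) * r) + - 1ℚ * 1ℚ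

  ev-⊕ : ∀ α β r → ev (α ⊕ β) r ≡ ev α r + ev β r
  ev-⊕ ⟨ u , v , w ⟩ ⟨ x , y , z ⟩ r rewrite ι-+ u x | ι-+ v y | ι-+ w z =
    identity (ι u) (ι v) (ι w) (ι x) (ι y) (ι z) r
    where
    identity : ∀ u v w x y z r →
      u + x + (v + y) * r + (w + z) * (r * r) ≡ u + v * r + w * (r * r) + (x + y * r + z * (r * r))
    identity = solve-∀ ℚ-ring

  ev-• : ∀ k α r → ev (k • α) r ≡ ι k * ev α r
  ev-• k ⟨ x , y , z ⟩ r rewrite ι-* k x | ι-* k y | ι-* k z =
    identity (ι k) (ι x) (ι y) (ι z) r
    where
    identity : ∀ k x y z r → k * x + k * y * r + k * z * (r * r) ≡ k * (x + y * r + z * (r * r))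
    identity = solve-∀ ℚ-ring

  -- Reducing the cubic term of x β(x) subtracts its coefficient times the minimal polynomial.
  ev-ρ· : ∀ β r → ev (ρ· β) r ≡ r * ev β r - ι (ℤ[ρ].c₂ β) * minpoly r
  ev-ρ· ⟨ x , y , z ⟩ r
    rewrite ι-+ x ((a ℤ.+ ℤ.+ 3) ℤ.* z) | ι-* (a ℤ.+ ℤ.+ 3) z | ι-+ y (a ℤ.* z) | ι-* a z =
    identity (ι a) (ι (a ℤ.+ ℤ.+ 3)) (ι x) (ι y) (ι z) r
    where
    identity : ∀ a a+3 x y z r →
      z + (x + a+3 * z) * r + (y + a * z) * (r * r) ≡
      r * (x + y * r + z * (r * r)) -
        z * (r * r * r + - 1ℚ * (a * (r * r)) + - 1ℚ * (a+3 * r) + - 1ℚ * 1ℚ)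
    identity = solve-∀ ℚ-ring

  -- α ⊗ β is the remainder of the product of α and β, as polynomials in x, modulo
  -- the minimal polynomial of ρ, and overflow α β is the quotient.
  overflow : ℤ[ρ] a → ℤ[ρ] a → ℤ[ρ] a
  overflow ⟨ u , v , w ⟩ ⟨ x , y , z ⟩ = ⟨ v ℤ.* z ℤ.+ w ℤ.* (y ℤ.+ a ℤ.* z) , w ℤ.* z , ℤ.+ 0 ⟩

  ev-⊗ : ∀ α β r → ev (α ⊗ β) r ≡ ev α r * ev β r - minpoly r * ev (overflow α β) r
  ev-⊗ α@(⟨ u , v , w ⟩) β@(⟨ x , y , z ⟩) r = begin
    ev (α ⊗ β) r
      ≡⟨ ev-⊕ (u • β ⊕ v • (ρ· β)) (w • (ρ· (ρ· β))) r ⟩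
    ev (u • β ⊕ v • (ρ· β)) r + ev (w • (ρ· (ρ· β))) r
      ≡⟨ cong₂ _+_ (trans (ev-⊕ (u • β) (v • (ρ· β)) r) (cong₂ _+_ (ev-• u β r) (ev-• v (ρ· β) r)))
                   (ev-• w (ρ· (ρ· β)) r) ⟩
    ι u * ev β r + ι v * ev (ρ· β) r + ι w * ev (ρ· (ρ· β)) r
      ≡⟨ cong₂ (λ p p′ → ι u * ev β r + ι v * p + ι w * p′) (ev-ρ· β r)
               (trans (ev-ρ· (ρ· β) r) (cong₂ (λ p p′ → r * p - p′ * minpoly r) (ev-ρ· β r) yz)) ⟩
    ι u * ev β r + ι v * (r * ev β r - ι z * minpoly r)
      + ι w * (r * (r * ev β r - ι z * minpoly r) - (ι y + ι a * ι z) * minpoly r)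
      ≡⟨ identity (ι u) (ι v) (ι w) (ι y) (ι z) (ι a) r (ev β r) (minpoly r) ⟩
    ev α r * ev β r - minpoly r * ((ι v * ι z + ι w * (ι y + ι a * ι z)) + ι w * ι z * r + 0ℚ * (r * r))
      ≡⟨ cong₂ (λ p p′ → ev α r * ev β r - minpoly r * (p + p′ * r + 0ℚ * (r * r))) const (sym (ι-* w z)) ⟩
    ev α r * ev β r - minpoly r * ev (overflow α β) r ∎
    where
    open ≡-Reasoning
    yz : ι (y ℤ.+ a ℤ.* z) ≡ ι y + ι a * ι z
    yz = trans (ι-+ y (a ℤ.* z)) (cong (λ p → ι y + p) (ι-* a z))
    const : ι v * ι z + ι w * (ι y + ι a * ι z) ≡ ι (v ℤ.* z ℤ.+ w ℤ.* (y ℤ.+ a ℤ.* z))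
    const = sym (trans (ι-+ (v ℤ.* z) (w ℤ.* (y ℤ.+ a ℤ.* z)))
      (cong₂ _+_ (ι-* v z) (trans (ι-* w (y ℤ.+ a ℤ.* z)) (cong (λ p → ι w * p) yz))))
    identity : ∀ u v w y z a r E F →
      u * E + v * (r * E - z * F) + w * (r * (r * E - z * F) - (y + a * z) * F) ≡
      (u + v * r + w * (r * r)) * E - F * ((v * z + w * (y + a * z)) + w * z * r + 0ℚ * (r * r))
    identity = solve-∀ ℚ-ring

  _at_ : ℤ[ρ] a → ℝ → ℕ → ℚ
  (α at r) n = ev α (seq r n)

  at-bounded : ∀ α r → Bounded (α at r)
  at-bounded α r = cauchy⇒bounded (isCauchy (⟦ α ⟧ r))

  infixl 6 _⊖_

  _⊖_ : ℤ[ρ] a → ℤ[ρ] a → ℤ[ρ] a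
  α ⊖ β = α ⊕ (ℤ.- ℤ.+ 1) • β

  ev-⊖ : ∀ α β r → ev α r - ev β r ≡ ev (α ⊖ β) r
  ev-⊖ α β r = sym (trans (ev-⊕ α ((ℤ.- ℤ.+ 1) • β) r)
    (trans (cong (λ p → ev α r + p) (ev-• (ℤ.- ℤ.+ 1) β r)) (identity (ev α r) (ev β r))))
    where
    identity : ∀ p p′ → p + - 1ℚ * p′ ≡ p - p′
    identity = solve-∀ ℚ-ring

  <ℝ⇒⊖-pos : ∀ α β r → ⟦ β ⟧ r <ℝ ⟦ α ⟧ r → Pos ((α ⊖ β) at r)
  <ℝ⇒⊖-pos α β r β<α = pos-ext (λ n → ev-⊖ α β (seq r n)) (<ℝ⇒pos (⟦ β ⟧ r) (⟦ α ⟧ r) β<α)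

  0<ℝ⇒pos : ∀ α r → fromℤ (ℤ.+ 0) <ℝ ⟦ α ⟧ r → Pos (α at r)
  0<ℝ⇒pos α r 0<α = pos-ext (λ n → +-identityʳ ((α at r) n)) (<ℝ⇒pos (fromℤ (ℤ.+ 0)) (⟦ α ⟧ r) 0<α)

  -- The image of α under ρ ↦ τ.
  conj : ℤ[ρ] a → ℤ[ρ] a → ℤ[ρ] a
  conj τ ⟨ u , v , w ⟩ = u • 1ρ ⊕ v • τ ⊕ w • (τ ⊗ τ)

  -- -1 - 1/ρ and -1/(1 + ρ).
  ρ′ᵉ ρ″ᵉ : ℤ[ρ] a
  ρ′ᵉ = ⟨ a ℤ.+ ℤ.+ 2 , a , ℤ.- ℤ.+ 1 ⟩
  ρ″ᵉ = ⟨ ℤ.- ℤ.+ 2 , ℤ.- (a ℤ.+ ℤ.+ 1) , ℤ.+ 1 ⟩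

  -- Two errors separate this value from α(r′): α(r′) - α(τ(r)) is a multiple of r′ - τ(r), and
  -- reducing τ² costs a multiple of `minpoly r`.
  ev-conj : ∀ τ α r r′ → ev (conj τ α) r ≡
    (ev α r′ - (r′ - ev τ r) * (ι (ℤ[ρ].c₁ α) + ι (ℤ[ρ].c₂ α) * (ev τ r + r′)))
    - minpoly r * ev (ℤ[ρ].c₂ α • overflow τ τ) r
  ev-conj τ α@(⟨ u , v , w ⟩) r r′ = begin
    ev (conj τ α) r
      ≡⟨ ev-⊕ (u • 1ρ ⊕ v • τ) (w • (τ ⊗ τ)) r ⟩
    ev (u • 1ρ ⊕ v • τ) r + ev (w • (τ ⊗ τ)) r
      ≡⟨ cong₂ _+_ (trans (ev-⊕ (u • 1ρ) (v • τ) r) (cong₂ _+_ (ev-• u 1ρ r) (ev-• v τ r)))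
                   (trans (ev-• w (τ ⊗ τ) r) (cong (λ p → ι w * p) (ev-⊗ τ τ r))) ⟩
    ι u * (1ℚ + 0ℚ * r + 0ℚ * (r * r)) + ι v * T + ι w * (T * T - minpoly r * c)
      ≡⟨ identity (ι u) (ι v) (ι w) r r′ T (minpoly r) c ⟩
    (ev α r′ - (r′ - T) * (ι v + ι w * (T + r′))) - minpoly r * (ι w * c)
      ≡⟨ cong (λ p → (ev α r′ - (r′ - T) * (ι v + ι w * (T + r′))) - minpoly r * p) (ev-• w (overflow τ τ) r) ⟨
    _ ∎
    where
    open ≡-Reasoning
    T c : ℚ
    T = ev τ r
    c = ev (overflow τ τ) r
    identity : ∀ u v w r r′ T F c →
      u * (1ℚ + 0ℚ * r + 0ℚ * (r * r)) + v * T + w * (T * T - F * c) ≡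
      ((u + v * r′ + w * (r′ * r′)) - (r′ - T) * (v + w * (T + r′))) - F * (w * c)
    identity = solve-∀ ℚ-ring

  cofactor : ℝ → ℝ → ℝ
  cofactor x r = (r *ℝ r -ℝ (fromℤ a +ℝ fromℤ (ℤ.+ 1)) *ℝ r -ℝ fromℤ (ℤ.+ 1)) -ℝ x *ℝ (r -ℝ fromℤ a -ℝ fromℤ (ℤ.+ 1))

  -- At an arbitrary r, `ρ′ᵉ` and `ρ″ᵉ` give the other two roots only modulo `minpoly r`; `cofactor`
  -- is the quotient of the resulting error by `minpoly r`.
  minpoly-factors : ∀ x r n → minpoly (seq x n) + minpoly (seq r n) * seq (cofactor x r) n ≡
    (seq x n - seq r n) * (seq x n - (ρ′ᵉ at r) n) * (seq x n - (ρ″ᵉ at r) n)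
  minpoly-factors x r n
    rewrite ι-+ a (ℤ.+ 3) | ι-+ a (ℤ.+ 2)
          | sym (ℤ.-1*i≡-i (a ℤ.+ ℤ.+ 1)) | ι-* (ℤ.- ℤ.+ 1) (a ℤ.+ ℤ.+ 1) | ι-+ a (ℤ.+ 1) =
    identity (ι a) (seq x n) (seq r n)
    where
    identity : ∀ a x r →
      (x * x * x + - 1ℚ * (a * (x * x)) + - 1ℚ * ((a + (ℤ.+ 3 / 1)) * x) + - 1ℚ * 1ℚ)
      + (r * r * r + - 1ℚ * (a * (r * r)) + - 1ℚ * ((a + (ℤ.+ 3 / 1)) * r) + - 1ℚ * 1ℚ)
        * ((r * r + - 1ℚ * ((a + 1ℚ) * r) + - 1ℚ * 1ℚ) + - 1ℚ * (x * (r + - 1ℚ * a + - 1ℚ * 1ℚ))) ≡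
      (x - r) * (x - (a + (ℤ.+ 2 / 1) + a * r + - 1ℚ * (r * r)))
        * (x - ((- (ℤ.+ 2 / 1)) + - 1ℚ * (a + 1ℚ) * r + 1ℚ * (r * r)))
    identity = solve-∀ ℚ-ring

open Evaluation

-- A solver for identities in ℤ[ρ]

7+_ : ℕ → ℤ
7+ b = ℤ.+ (7 ℕ.+ b)

num : ∀ {n} → ℕ → Polynomial n
num m = con (ℤ.+ m)

-1̲ : ∀ {n} → Polynomial n
-1̲ = con (ℤ.- ℤ.+ 1)

-- The first variable is b, where a = 7 + b.
a̲ : ∀ {n} → Polynomial (suc n)
a̲ = num 7 :+ var zero

infixl 6 _⊞_
infixl 7 _⊠_ _⊡_

-- Expressions in ℤ[ρ] whose coefficients are integer polynomials in b and n variables.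
data Exp (n : ℕ) : Set where
  tri     : (p₀ p₁ p₂ : Polynomial (suc n)) → Exp n
  _⊞_ _⊠_ : Exp n → Exp n → Exp n
  _⊡_     : Polynomial (suc n) → Exp n → Exp n

⟪_⟫ : ∀ {n} → Exp n → ∀ {b} → Vec ℤ n → ℤ[ρ] (7+ b)
⟪ tri p₀ p₁ p₂ ⟫ {b} η = ⟨ ⟦ p₀ ⟧P (ℤ.+ b ∷ η) , ⟦ p₁ ⟧P (ℤ.+ b ∷ η) , ⟦ p₂ ⟧P (ℤ.+ b ∷ η) ⟩
⟪ d ⊞ e ⟫ η = ⟪ d ⟫ η ⊕ ⟪ e ⟫ η
⟪ d ⊠ e ⟫ η = ⟪ d ⟫ η ⊗ ⟪ e ⟫ η
⟪ p ⊡ e ⟫ {b} η = ⟦ p ⟧P (ℤ.+ b ∷ η) • ⟪ e ⟫ η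

record NF (n : ℕ) : Set where
  constructor nf
  field n₀ n₁ n₂ : Normal (suc n)

aᴺ a+3ᴺ : ∀ {n} → Normal (suc n)
aᴺ = normalise a̲
a+3ᴺ = normalise (a̲ :+ num 3)

_⊕ᴺ_ : ∀ {n} → NF n → NF n → NF n
nf u v w ⊕ᴺ nf x y z = nf (u +N x) (v +N y) (w +N z)

_•ᴺ_ : ∀ {n} → Normal (suc n) → NF n → NF n
k •ᴺ nf x y z = nf (k *N x) (k *N y) (k *N z)

ρ·ᴺ_ : ∀ {n} → NF n → NF n
ρ·ᴺ nf x y z = nf z (x +N (a+3ᴺ *N z)) (y +N (aᴺ *N z))

_⊗ᴺ_ : ∀ {n} → NF n → NF n → NF n
nf u v w ⊗ᴺ β = ((u •ᴺ β) ⊕ᴺ (v •ᴺ (ρ·ᴺ β))) ⊕ᴺ (w •ᴺ (ρ·ᴺ (ρ·ᴺ β)))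

norm : ∀ {n} → Exp n → NF n
norm (tri p₀ p₁ p₂) = nf (normalise p₀) (normalise p₁) (normalise p₂)
norm (d ⊞ e) = norm d ⊕ᴺ norm e
norm (d ⊠ e) = norm d ⊗ᴺ norm e
norm (p ⊡ e) = normalise p •ᴺ norm e

tri-cong : ∀ {a u v w x y z} → u ≡ x → v ≡ y → w ≡ z → _≡_ {A = ℤ[ρ] a} ⟨ u , v , w ⟩ ⟨ x , y , z ⟩
tri-cong refl refl refl = refl

module _ {b n : ℕ} (η : Vec ℤ n) where

  sem : NF n → ℤ[ρ] (7+ b)
  sem (nf x y z) = ⟨ ⟦ x ⟧N (ℤ.+ b ∷ η) , ⟦ y ⟧N (ℤ.+ b ∷ η) , ⟦ z ⟧N (ℤ.+ b ∷ η) ⟩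

  sem-⊕ : ∀ α β → sem (α ⊕ᴺ β) ≡ sem α ⊕ sem β
  sem-⊕ (nf u v w) (nf x y z) = tri-cong (+N-homo u x _) (+N-homo v y _) (+N-homo w z _)

  sem-• : ∀ k α → sem (k •ᴺ α) ≡ ⟦ k ⟧N (ℤ.+ b ∷ η) • sem α
  sem-• k (nf x y z) = tri-cong (*N-homo k x _) (*N-homo k y _) (*N-homo k z _)

  sem-ρ· : ∀ α → sem (ρ·ᴺ α) ≡ ρ· sem α
  sem-ρ· (nf x y z) = tri-cong refl
    (trans (+N-homo x (a+3ᴺ *N z) _) (cong (λ p → ⟦ x ⟧N (ℤ.+ b ∷ η) ℤ.+ p)
      (trans (*N-homo a+3ᴺ z _) (cong (λ p → p ℤ.* ⟦ z ⟧N (ℤ.+ b ∷ η)) (correct (a̲ :+ num 3) (ℤ.+ b ∷ η))))))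
    (trans (+N-homo y (aᴺ *N z) _) (cong (λ p → ⟦ y ⟧N (ℤ.+ b ∷ η) ℤ.+ p)
      (trans (*N-homo aᴺ z _) (cong (λ p → p ℤ.* ⟦ z ⟧N (ℤ.+ b ∷ η)) (correct a̲ (ℤ.+ b ∷ η))))))

  sem-⊗ : ∀ α β → sem (α ⊗ᴺ β) ≡ sem α ⊗ sem β
  sem-⊗ (nf u v w) β = trans (sem-⊕ ((u •ᴺ β) ⊕ᴺ (v •ᴺ (ρ·ᴺ β))) (w •ᴺ (ρ·ᴺ (ρ·ᴺ β)))) (cong₂ _⊕_
    (trans (sem-⊕ (u •ᴺ β) (v •ᴺ (ρ·ᴺ β)))
      (cong₂ _⊕_ (sem-• u β) (trans (sem-• v (ρ·ᴺ β)) (cong (⟦ v ⟧N (ℤ.+ b ∷ η) •_) (sem-ρ· β)))))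
    (trans (sem-• w (ρ·ᴺ (ρ·ᴺ β)))
      (cong (⟦ w ⟧N (ℤ.+ b ∷ η) •_) (trans (sem-ρ· (ρ·ᴺ β)) (cong ρ·_ (sem-ρ· β))))))

  norm-correct : ∀ e → sem (norm e) ≡ ⟪ e ⟫ η
  norm-correct (tri p₀ p₁ p₂) = tri-cong (correct p₀ _) (correct p₁ _) (correct p₂ _)
  norm-correct (d ⊞ e) = trans (sem-⊕ (norm d) (norm e)) (cong₂ _⊕_ (norm-correct d) (norm-correct e))
  norm-correct (d ⊠ e) = trans (sem-⊗ (norm d) (norm e)) (cong₂ _⊗_ (norm-correct d) (norm-correct e))
  norm-correct (p ⊡ e) = trans (sem-• (normalise p) (norm e)) (cong₂ _•_ (correct p _) (norm-correct e))

  -- Proof by reflection: equal normal forms of the three coefficients give an identity in ℤ[ρ], so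
  -- every later certificate is closed by `refl`.
  decide : ∀ d e → norm d ≡ norm e → ⟪ d ⟫ {b} η ≡ ⟪ e ⟫ η
  decide d e eq = trans (sym (norm-correct d)) (trans (cong sem eq) (norm-correct e))

v : ∀ {n} → Fin n → Polynomial (suc n)
v i = var (suc i)

⊗-comm : ∀ {b} (α β : ℤ[ρ] (7+ b)) → α ⊗ β ≡ β ⊗ α
⊗-comm ⟨ u , v′ , w ⟩ ⟨ x , y , z ⟩ = decide (u ∷ v′ ∷ w ∷ x ∷ y ∷ z ∷ []) (α ⊠ β) (β ⊠ α) refl
  where
  α β : Exp 6
  α = tri (v (# 0)) (v (# 1)) (v (# 2))
  β = tri (v (# 3)) (v (# 4)) (v (# 5))

⊗-assoc : ∀ {b} (α β γ′ : ℤ[ρ] (7+ b)) → (α ⊗ β) ⊗ γ′ ≡ α ⊗ (β ⊗ γ′)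
⊗-assoc ⟨ u , v′ , w ⟩ ⟨ x , y , z ⟩ ⟨ x′ , y′ , z′ ⟩ =
  decide (u ∷ v′ ∷ w ∷ x ∷ y ∷ z ∷ x′ ∷ y′ ∷ z′ ∷ []) ((α ⊠ β) ⊠ γ′) (α ⊠ (β ⊠ γ′)) refl
  where
  α β γ′ : Exp 9
  α = tri (v (# 0)) (v (# 1)) (v (# 2))
  β = tri (v (# 3)) (v (# 4)) (v (# 5))
  γ′ = tri (v (# 6)) (v (# 7)) (v (# 8))

-- Conjugation and the norm

1̲ ρ′̲ ρ″̲ : ∀ {n} → Exp n
1̲ = tri (num 1) (num 0) (num 0)
ρ′̲ = tri (a̲ :+ num 2) a̲ -1̲
ρ″̲ = tri (con (ℤ.- ℤ.+ 2)) (:- (a̲ :+ num 1)) (num 1)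

conj̲ : ∀ {n} → Exp n → (p₀ p₁ p₂ : Polynomial (suc n)) → Exp n
conj̲ τ p₀ p₁ p₂ = p₀ ⊡ 1̲ ⊞ p₁ ⊡ τ ⊞ p₂ ⊡ (τ ⊠ τ)

module _ {b : ℕ} where

  private
    module Symbols {n : ℕ} where
      a+3 U V W X Y Z : Polynomial (suc (6 ℕ.+ n))
      a+3 = a̲ :+ num 3
      U = v (# 0)
      V = v (# 1)
      W = v (# 2)
      X = v (# 3)
      Y = v (# 4)
      Z = v (# 5)

      conj-⊠ ⊠-conj : Exp (6 ℕ.+ n) → Exp (6 ℕ.+ n)
      ⊠-conj τ = conj̲ τ U V W ⊠ conj̲ τ X Y Z
      conj-⊠ τ = conj̲ τ
        (U :* X :+ V :* Z :+ W :* (Y :+ a̲ :* Z))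
        (U :* Y :+ V :* (X :+ a+3 :* Z) :+ W :* (Z :+ a+3 :* (Y :+ a̲ :* Z)))
        (U :* Z :+ V :* (Y :+ a̲ :* Z) :+ W :* ((X :+ a+3 :* Z) :+ a̲ :* (Y :+ a̲ :* Z)))

  -- Substitution for ρ is multiplicative because the substituted element is again a root of the
  -- minimal polynomial; comparing normal forms verifies this.
  conj′-⊗ : (α β : ℤ[ρ] (7+ b)) → conj ρ′ᵉ α ⊗ conj ρ′ᵉ β ≡ conj ρ′ᵉ (α ⊗ β)
  conj′-⊗ ⟨ u , v , w ⟩ ⟨ x , y , z ⟩ = decide (u ∷ v ∷ w ∷ x ∷ y ∷ z ∷ [])
    (Symbols.⊠-conj ρ′̲) (Symbols.conj-⊠ ρ′̲) refl

  conj″-⊗ : (α β : ℤ[ρ] (7+ b)) → conj ρ″ᵉ α ⊗ conj ρ″ᵉ β ≡ conj ρ″ᵉ (α ⊗ β)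
  conj″-⊗ ⟨ u , v , w ⟩ ⟨ x , y , z ⟩ = decide (u ∷ v ∷ w ∷ x ∷ y ∷ z ∷ [])
    (Symbols.⊠-conj ρ″̲) (Symbols.conj-⊠ ρ″̲) refl

  N : ℤ[ρ] (7+ b) → ℤ[ρ] (7+ b)
  N α = α ⊗ conj ρ′ᵉ α ⊗ conj ρ″ᵉ α

  -- The norm is invariant under conjugation. In its symbolic normal form the coefficients of ρ and
  -- ρ² are zero, so they evaluate to 0 by computation.
  N-rational : ∀ α → N α ≡ ⟨ ℤ[ρ].c₀ (N α) , ℤ.+ 0 , ℤ.+ 0 ⟩
  N-rational α@(⟨ u , v′ , w ⟩) =
    tri-cong refl (cong ℤ[ρ].c₁ (sym correct-N)) (cong ℤ[ρ].c₂ (sym correct-N))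
    where
    U V W : Polynomial 4
    U = v (# 0)
    V = v (# 1)
    W = v (# 2)
    correct-N : sem (u ∷ v′ ∷ w ∷ []) (norm (tri U V W ⊠ conj̲ ρ′̲ U V W ⊠ conj̲ ρ″̲ U V W)) ≡ N α
    correct-N = norm-correct (u ∷ v′ ∷ w ∷ []) (tri U V W ⊠ conj̲ ρ′̲ U V W ⊠ conj̲ ρ″̲ U V W)

⊗-commutativeSemigroup : ℕ → CommutativeSemigroup _ _
⊗-commutativeSemigroup b = record
  { Carrier = ℤ[ρ] (7+ b)
  ; _≈_ = _≡_
  ; _∙_ = _⊗_
  ; isCommutativeSemigroup = record
    { isSemigroup = record
      { isMagma = record { isEquivalence = isEquivalence ; ∙-cong = cong₂ _⊗_ }
      ; assoc = ⊗-assoc }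
    ; comm = ⊗-comm }
  }

N-⊗-inverse : ∀ {b} (α β : ℤ[ρ] (7+ b)) → α ⊗ β ≡ 1ρ → N α ⊗ N β ≡ 1ρ
N-⊗-inverse {b} α β αβ≡1 = begin
  N α ⊗ N β
    ≡⟨ interchange (α ⊗ conj ρ′ᵉ α) (conj ρ″ᵉ α) (β ⊗ conj ρ′ᵉ β) (conj ρ″ᵉ β) ⟩
  ((α ⊗ conj ρ′ᵉ α) ⊗ (β ⊗ conj ρ′ᵉ β)) ⊗ (conj ρ″ᵉ α ⊗ conj ρ″ᵉ β)
    ≡⟨ cong (_⊗ (conj ρ″ᵉ α ⊗ conj ρ″ᵉ β)) (interchange α (conj ρ′ᵉ α) β (conj ρ′ᵉ β)) ⟩
  ((α ⊗ β) ⊗ (conj ρ′ᵉ α ⊗ conj ρ′ᵉ β)) ⊗ (conj ρ″ᵉ α ⊗ conj ρ″ᵉ β)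
    ≡⟨ cong₂ _⊗_ (cong ((α ⊗ β) ⊗_) (conj′-⊗ α β)) (conj″-⊗ α β) ⟩
  N (α ⊗ β)
    ≡⟨ cong N αβ≡1 ⟩
  N 1ρ
    ≡⟨ decide [] (1̲ ⊠ conj̲ ρ′̲ (num 1) (num 0) (num 0) ⊠ conj̲ ρ″̲ (num 1) (num 0) (num 0)) 1̲ refl ⟩
  1ρ ∎
  where
  open ≡-Reasoning
  open CommutativeSemigroupProperties (⊗-commutativeSemigroup b) using (interchange)

-- The order on ℤ[ρ]

module Order (b : ℕ) (R : Roots (7+ b)) where

  open import Data.Rational using (ℚ; 0ℚ; 1ℚ; ½; _+_; _*_; -_; _-_; _<_)
  open import Data.Rational.Properties using (_<?_; positive⁻¹)
  open Roots R

  -- Only the embedding at ρ is used: positivity at ρ′ and ρ″ enters as positivity of the conjugates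
  -- under `ρ′ᵉ` and `ρ″ᵉ`.
  record Positive (α : ℤ[ρ] (7+ b)) : Set where
    constructor mkP
    field at-ρ : Pos (α at ρ)

  0ρ : ℤ[ρ] (7+ b)
  0ρ = ⟨ ℤ.+ 0 , ℤ.+ 0 , ℤ.+ 0 ⟩

  null-minpoly : ∀ r → f (7+ b) r ≈ℝ fromℤ (ℤ.+ 0) → Null (λ n → minpoly {7+ b} (seq r n))
  null-minpoly r r-root = ≈0⇒null (f (7+ b) r) r-root

  Positive-⊕ : ∀ {α β} → Positive α → Positive β → Positive (α ⊕ β)
  Positive-⊕ {α} {β} (mkP p) (mkP p′) = mkP (pos-ext (λ n → sym (ev-⊕ α β (seq ρ n))) (pos-+ p p′))

  excess : ℤ[ρ] (7+ b) → ℤ[ρ] (7+ b) → ℕ → ℚ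
  excess α β n = minpoly {7+ b} (seq ρ n) * (overflow α β at ρ) n

  null-excess : ∀ α β → Null (excess α β)
  null-excess α β = null*bounded⇒null (null-minpoly ρ ρ-root) (at-bounded (overflow α β) ρ)

  -- The value of the product differs from the product of the values by a multiple of the minimal
  -- polynomial at ρ, which is null.
  Positive-⊗ : ∀ {α β} → Positive α → Positive β → Positive (α ⊗ β)
  Positive-⊗ {α} {β} (mkP p) (mkP p′) = mkP (pos-ext (λ n → sym (ev-⊗ α β (seq ρ n)))
    (pos+null⇒pos {λ n → (α at ρ) n * (β at ρ) n} {λ n → - excess α β n}
      (pos-* p p′) (null-neg (null-excess α β))))

  Positive-cancel : ∀ {α β} → Positive β → Positive (α ⊗ β) → Positive α
  Positive-cancel {α} {β} (mkP p) (mkP p′) = mkP (pos-cancelʳ (at-bounded β ρ) p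
    (pos-ext (λ n → trans (cong (λ x → x + excess α β n) (ev-⊗ α β (seq ρ n)))
                          (identity ((α at ρ) n * (β at ρ) n) (excess α β n)))
      (pos+null⇒pos {(α ⊗ β) at ρ} {excess α β} p′ (null-excess α β))))
    where
    identity : ∀ p p′ → p - p′ + p′ ≡ p
    identity = solve-∀ ℚ-ring

  ¬Positive-0 : ¬ Positive 0ρ
  ¬Positive-0 (mkP p) = ¬pos-0 (pos-ext (λ n → identity (seq ρ n)) p)
    where
    identity : ∀ r → 0ℚ + 0ℚ * r + 0ℚ * (r * r) ≡ 0ℚ
    identity = solve-∀ ℚ-ring

  Positive-1 : Positive 1ρ
  Positive-1 = mkP (½ , positive⁻¹ ½ , 0 , λ n _ → subst (½ <_) (identity (seq ρ n)) ½<1)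
    where
    ½<1 : ½ < 1ℚ
    ½<1 = from-yes (½ <? 1ℚ)
    identity : ∀ r → 1ℚ ≡ 1ℚ + 0ℚ * r + 0ℚ * (r * r)
    identity = solve-∀ ℚ-ring

  -- Weak inequalities come from integers, from `_⪰_` or from an equation, so this disjunction is
  -- available although the sign of a real is not decidable.
  data NonNegative (α : ℤ[ρ] (7+ b)) : Set where
    zero : α ≡ 0ρ → NonNegative α
    pos  : Positive α → NonNegative α

  ℕ-nonneg : ∀ m → NonNegative ⟨ ℤ.+ m , ℤ.+ 0 , ℤ.+ 0 ⟩
  ℕ-nonneg zero = zero refl
  ℕ-nonneg (suc m) with ℕ-nonneg m
  ... | zero refl = pos Positive-1
  ... | pos p = pos (Positive-⊕ Positive-1 p)

  ℕ-pos : ∀ m → Positive ⟨ ℤ.+ suc m , ℤ.+ 0 , ℤ.+ 0 ⟩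
  ℕ-pos zero = Positive-1
  ℕ-pos (suc m) = Positive-⊕ Positive-1 (ℕ-pos m)

  ⊕-identityˡ : ∀ α → 0ρ ⊕ α ≡ α
  ⊕-identityˡ ⟨ u , v , w ⟩ = tri-cong (ℤ.+-identityˡ u) (ℤ.+-identityˡ v) (ℤ.+-identityˡ w)

  ⊕-identityʳ : ∀ α → α ⊕ 0ρ ≡ α
  ⊕-identityʳ ⟨ u , v , w ⟩ = tri-cong (ℤ.+-identityʳ u) (ℤ.+-identityʳ v) (ℤ.+-identityʳ w)

  ⊗-zeroˡ : ∀ α → 0ρ ⊗ α ≡ 0ρ
  ⊗-zeroˡ ⟨ u , v′ , w ⟩ = decide (u ∷ v′ ∷ w ∷ [])
    (tri (num 0) (num 0) (num 0) ⊠ tri (v (# 0)) (v (# 1)) (v (# 2)))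
    (tri (num 0) (num 0) (num 0)) refl

  ⊗-zeroʳ : ∀ α → α ⊗ 0ρ ≡ 0ρ
  ⊗-zeroʳ α = trans (⊗-comm α 0ρ) (⊗-zeroˡ α)

  -- The Boolean tracks strictness: a sum is strict if a summand is, a product if both factors are.
  -- Strictness of a certificate is thus computed.
  Sign : Bool → ℤ[ρ] (7+ b) → Set
  Sign true = Positive
  Sign false = NonNegative

  weaken : ∀ σ {α} → Sign σ α → NonNegative α
  weaken true p = pos p
  weaken false p = p

  Sign-⊕ : ∀ σ τ {α β} → Sign σ α → Sign τ β → Sign (σ ∨ τ) (α ⊕ β)
  Sign-⊕ true τ {α} p p′ with weaken τ p′
  ... | zero refl = subst Positive (sym (⊕-identityʳ α)) p
  ... | pos p″ = Positive-⊕ p p″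
  Sign-⊕ false τ {_} {β} (zero refl) p′ = subst (Sign τ) (sym (⊕-identityˡ β)) p′
  Sign-⊕ false true (pos p) p′ = Positive-⊕ p p′
  Sign-⊕ false false {α} (pos p) (zero refl) = pos (subst Positive (sym (⊕-identityʳ α)) p)
  Sign-⊕ false false (pos p) (pos p′) = pos (Positive-⊕ p p′)

  NonNegative-⊗ : ∀ {α β} → NonNegative α → NonNegative β → NonNegative (α ⊗ β)
  NonNegative-⊗ {_} {β} (zero refl) _ = zero (⊗-zeroˡ β)
  NonNegative-⊗ {α} (pos _) (zero refl) = zero (⊗-zeroʳ α)
  NonNegative-⊗ (pos p) (pos p′) = pos (Positive-⊗ p p′)

  Sign-⊗ : ∀ σ τ {α β} → Sign σ α → Sign τ β → Sign (σ ∧ τ) (α ⊗ β)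
  Sign-⊗ true true p p′ = Positive-⊗ p p′
  Sign-⊗ true false p p′ = NonNegative-⊗ (pos p) p′
  Sign-⊗ false τ p p′ = NonNegative-⊗ p (weaken τ p′)

  -- Signed σ η e: the value of e at η is positive (σ = true) or nonnegative (σ = false).
  record Signed (σ : Bool) {n} (η : Vec ℤ n) (e : Exp n) : Set where
    constructor c
    field sign : Sign σ (⟪ e ⟫ η)

  int : ∀ {n} → Polynomial (suc n) → Exp n
  int p = tri p (num 0) (num 0)

  s̲ t̲ ρ̲ 0̲ : ∀ {n} → Exp n
  0̲ = int (num 0)
  s̲ = -1̲ ⊡ ρ″̲
  t̲ = int -1̲ ⊞ -1̲ ⊡ ρ′̲
  ρ̲ = tri (num 0) (num 1) (num 0)

  module _ {n : ℕ} {η : Vec ℤ n} where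

    infixl 6 _⊹_
    infixl 7 _⋆_

    _⊹_ : ∀ {σ τ d e} → Signed σ η d → Signed τ η e → Signed (σ ∨ τ) η (d ⊞ e)
    _⊹_ {σ} {τ} (c x) (c y) = c (Sign-⊕ σ τ x y)

    _⋆_ : ∀ {σ τ d e} → Signed σ η d → Signed τ η e → Signed (σ ∧ τ) η (d ⊠ e)
    _⋆_ {σ} {τ} (c x) (c y) = c (Sign-⊗ σ τ x y)

    convert : ∀ {σ d e} → Signed σ η d → norm d ≡ norm e → Signed σ η e
    convert {σ} {d} {e} (c x) eq = c (subst (Sign σ) (decide η d e eq) x)

    -- e is a certificate for d ≤ 0: a combination of nonnegative terms that equals -d.
    refute : ∀ {σ τ d e} → Signed σ η d → Signed τ η e → σ ∨ τ ≡ true → norm (d ⊞ e) ≡ norm {n} 0̲ → ⊥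
    refute {σ} {τ} {d} {e} x y strict eq with σ ∨ τ | x ⊹ y
    refute {d = d} {e} x y refl eq | true | c z = ¬Positive-0 (subst Positive (decide η (d ⊞ e) 0̲ eq) z)

    one : Signed true η 1̲
    one = c Positive-1

    lit : ∀ m → Signed (0 ℕ.<ᵇ m) η (int (con (ℤ.+ m)))
    lit zero = c (ℕ-nonneg 0)
    lit (suc m) = c (ℕ-pos m)

    b′ : Signed false η (int (var zero))
    b′ = c (ℕ-nonneg b)

    a′ : Signed true η (int (num 7) ⊞ int (var zero))
    a′ = lit 7 ⊹ b′

    cancel : ∀ {d e} → Signed true η e → norm (d ⊠ e) ≡ norm {n} 1̲ → Signed true η d
    cancel {d} {e} (c x) eq = c (Positive-cancel x (subst Positive (sym (decide η (d ⊠ e) 1̲ eq)) Positive-1))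

  private
    ρ₀ : Signed true [] ρ̲
    -- ρ = (ρ - a - 1) + (a + 1), with the first summand positive by `a+1<ρ`.
    ρ₀ = convert (c {e = ρ-a-1} (mkP ρ-a-1>0) ⊹ (a′ ⊹ one)) refl
      where
      ρ-a-1 : Exp 0
      ρ-a-1 = ρ̲ ⊞ -1̲ ⊡ int (a̲ :+ num 1)
      identity : ∀ r k → 0ℚ + 1ℚ * r + 0ℚ * (r * r) - (k + 0ℚ * r + 0ℚ * (r * r)) ≡ r - k
      identity = solve-∀ ℚ-ring
      ρ-a-1>0 : Pos (⟪ ρ-a-1 ⟫ {b} [] at ρ)
      ρ-a-1>0 = pos-ext (λ k → trans (sym (identity (seq ρ k) (ι (7+ b ℤ.+ ℤ.+ 1))))
          (ev-⊖ {7+ b} gen ⟨ 7+ b ℤ.+ ℤ.+ 1 , ℤ.+ 0 , ℤ.+ 0 ⟩ (seq ρ k)))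
        (<ℝ⇒pos (fromℤ (7+ b ℤ.+ ℤ.+ 1)) ρ a+1<ρ)

    t₀ : Signed true [] t̲
    -- The identities here and for `s₀` are t ρ = 1 and s (1 + ρ) = 1.
    t₀ = cancel ρ₀ refl

    s₀ : Signed true [] s̲
    s₀ = cancel (one ⊹ ρ₀) refl

  module _ {n : ℕ} {η : Vec ℤ n} where

    -- A closed expression has the same value at every `η`, so its sign at `[]` carries over.
    ρ⁺ : Signed true η ρ̲
    ρ⁺ = c (Signed.sign ρ₀)

    t⁺ : Signed true η t̲
    t⁺ = c (Signed.sign t₀)

    s⁺ : Signed true η s̲
    s⁺ = c (Signed.sign s₀)

  -- The roots ρ′ and ρ″ as elements of ℤ[ρ]

  bounded-cofactor : ∀ x → Bounded (seq (cofactor {7+ b} x ρ))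
  bounded-cofactor x = cauchy⇒bounded (isCauchy (cofactor {7+ b} x ρ))

  null-factors : ∀ x → f (7+ b) x ≈ℝ fromℤ (ℤ.+ 0) →
    Null (λ n → (seq x n - seq ρ n) * (seq x n - (ρ′ᵉ {7+ b} at ρ) n) * (seq x n - (ρ″ᵉ {7+ b} at ρ) n))
  null-factors x x-root = null-ext (minpoly-factors {7+ b} x ρ)
    (null-+ (null-minpoly x x-root) (null*bounded⇒null (null-minpoly ρ ρ-root) (bounded-cofactor x)))

  -- ρ′ is a root of (x - ρ)(x - ρ′ᵉ)(x - ρ″ᵉ), and ρ′ < -1 separates it from ρ and ρ″ᵉ.
  ρ′≈ : Null (λ n → seq ρ′ n - (ρ′ᵉ {7+ b} at ρ) n)
  ρ′≈ = null-cancelʳ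
    (pos-* (pos-ext (λ n → identity₁ (seq ρ n) (seq ρ′ n))
              (pos-+ (Positive.at-ρ (Signed.sign {n = 0} {[]} (one ⊹ ρ⁺))) -1-ρ′))
           (pos-ext (λ n → trans (cong (λ p → p + (- 1ℚ - seq ρ′ n)) (ev-⊕ {7+ b} ρ″ᵉ 1ρ (seq ρ n)))
                                 (identity₂ (seq ρ n) (seq ρ′ n) ((ρ″ᵉ {7+ b} at ρ) n)))
              -- `ρ″ᵉ` lies above -1, since 1 + ρ″ = 1 - s = s ρ.
              (pos-+ (Positive.at-ρ (Signed.sign {n = 0} {[]} (convert {e = ρ″̲ ⊞ 1̲} (s⁺ ⋆ ρ⁺) refl))) -1-ρ′)))
    (null-ext (λ n → identity₃ (seq ρ′ n) (seq ρ n) ((ρ′ᵉ {7+ b} at ρ) n) ((ρ″ᵉ {7+ b} at ρ) n))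
      (null-factors ρ′ ρ′-root))
    where
    -1-ρ′ : Pos (λ n → - 1ℚ - seq ρ′ n)
    -1-ρ′ = <ℝ⇒pos ρ′ (fromℤ (ℤ.- ℤ.+ 1)) ρ′<-1
    identity₁ : ∀ r x → (1ℚ + 1ℚ * r + 0ℚ * (r * r)) + (- 1ℚ - x) ≡ r - x
    identity₁ = solve-∀ ℚ-ring
    identity₂ : ∀ r x y → (y + (1ℚ + 0ℚ * r + 0ℚ * (r * r))) + (- 1ℚ - x) ≡ y - x
    identity₂ = solve-∀ ℚ-ring
    identity₃ : ∀ x r y z → (x - r) * (x - y) * (x - z) ≡ (x - y) * ((r - x) * (z - x))
    identity₃ = solve-∀ ℚ-ring

  -- Likewise, -1 < ρ″ < 0 separates ρ″ from ρ′ᵉ and ρ.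
  ρ″≈ : Null (λ n → seq ρ″ n - (ρ″ᵉ {7+ b} at ρ) n)
  ρ″≈ = null-cancelʳ
    (pos-* (pos-ext (λ n → identity₁ (seq ρ n) (seq ρ″ n))
              (pos-+ (Positive.at-ρ (Signed.sign {n = 0} {[]} ρ⁺)) (<ℝ⇒pos ρ″ (fromℤ (ℤ.+ 0)) ρ″<0)))
           (pos-ext (λ n → trans (cong (λ p → p + (seq ρ″ n - - 1ℚ)) (sym (ev-⊖ ⟨ ℤ.- ℤ.+ 1 , ℤ.+ 0 , ℤ.+ 0 ⟩ (ρ′ᵉ {7+ b}) (seq ρ n))))
                                 (identity₂ (seq ρ n) (seq ρ″ n) ((ρ′ᵉ {7+ b} at ρ) n)))
              (pos-+ (Positive.at-ρ (Signed.sign {n = 0} {[]} t⁺)) (<ℝ⇒pos (fromℤ (ℤ.- ℤ.+ 1)) ρ″ -1<ρ″))))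
    (null-ext (λ n → identity₃ (seq ρ″ n) (seq ρ n) ((ρ′ᵉ {7+ b} at ρ) n) ((ρ″ᵉ {7+ b} at ρ) n))
      (null-neg (null-factors ρ″ ρ″-root)))
    where
    identity₁ : ∀ r x → (0ℚ + 1ℚ * r + 0ℚ * (r * r)) + (0ℚ - x) ≡ r - x
    identity₁ = solve-∀ ℚ-ring
    identity₂ : ∀ r x y → ((- 1ℚ + 0ℚ * r + 0ℚ * (r * r)) - y) + (x - - 1ℚ) ≡ x - y
    identity₂ = solve-∀ ℚ-ring
    identity₃ : ∀ x r y z → - ((x - r) * (x - y) * (x - z)) ≡ (x - z) * ((r - x) * (x - y))
    identity₃ = solve-∀ ℚ-ring

  -- Moves an inequality from the root r to ρ: the errors `near` and `far` of `ev-conj` are null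
  -- because r - τ(ρ) and the minimal polynomial at ρ are.
  conj-pos : ∀ τ r → Null (λ n → seq r n - (τ at ρ) n) → ∀ α → Pos (α at r) → Positive (conj τ α)
  conj-pos τ r r≈τ α p = mkP (pos-ext (λ n → sym (ev-conj τ α (seq ρ n) (seq r n)))
    (pos+null⇒pos {λ n → (α at r) n - near n} {λ n → - far n}
      (pos+null⇒pos {α at r} {λ n → - near n} p (null-neg (null*bounded⇒null r≈τ
        (cauchy⇒bounded (isCauchy (fromℤ (ℤ[ρ].c₁ α) +ℝ fromℤ (ℤ[ρ].c₂ α) *ℝ (⟦ τ ⟧ ρ +ℝ r)))))))
      (null-neg (null*bounded⇒null (null-minpoly ρ ρ-root) (at-bounded (ℤ[ρ].c₂ α • overflow τ τ) ρ)))))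
    where
    near far : ℕ → ℚ
    near n = (seq r n - (τ at ρ) n) * (ι (ℤ[ρ].c₁ α) + ι (ℤ[ρ].c₂ α) * ((τ at ρ) n + seq r n))
    far n = minpoly {7+ b} (seq ρ n) * ((ℤ[ρ].c₂ α • overflow τ τ) at ρ) n

-- The classification of small units

-- i + j (1 + ρ) + k ρ′, where ρ′ = a + 2 + a ρ - ρ².
fromIJK : ∀ {a} → ℤ → ℤ → ℤ → ℤ[ρ] a
fromIJK {a} i j k = ⟨ i ℤ.+ j ℤ.+ k ℤ.* (a ℤ.+ ℤ.+ 2) , j ℤ.+ k ℤ.* a , ℤ.- k ⟩

module Classification (b : ℕ) (R : Roots (7+ b)) where
  open Order b R

  record SmallUnit (ε : ℤ[ρ] (7+ b)) : Set where
    field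
      x>0 : Positive ε
      y>0 : Positive (conj ρ′ᵉ ε)
      z>0 : Positive (conj ρ″ᵉ ε)
      x≤ : NonNegative (γ (7+ b) ⊖ ε)
      y≤ : NonNegative (conj ρ′ᵉ (γ (7+ b) ⊖ ε))
      z≤ : NonNegative (conj ρ″ᵉ (γ (7+ b) ⊖ ε))
      xyz≡1 : N ε ≡ 1ρ

  record NonNeg {n} (η : Vec ℤ n) (p : Polynomial (suc n)) : Set where
    constructor nonNeg
    field proof : ℤ.+ 0 ℤ.≤ ⟦ p ⟧P (ℤ.+ b ∷ η)

  module _ {n : ℕ} {η : Vec ℤ n} where

    -- For an integer p, failure of p ≥ 0 means -1 - p ≥ 0, so either case supplies a nonnegative
    -- coefficient for certificates.
    split : ∀ p → NonNeg η p ⊎ NonNeg η (-1̲ :- p)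
    split p with ⟦ p ⟧P (ℤ.+ b ∷ η) in eq
    ... | ℤ.+ m = inj₁ (nonNeg (subst (ℤ.+ 0 ℤ.≤_) (sym eq) (ℤ.+≤+ ℕ.z≤n)))
    ... | ℤ.-[1+ m ] = inj₂ (nonNeg (subst (λ x → ℤ.+ 0 ℤ.≤ ℤ.-[1+ 0 ] ℤ.+ ℤ.- x) (sym eq) (ℤ.+≤+ ℕ.z≤n)))

    ⌊_⌋ : ∀ {p} → NonNeg η p → Signed false η (int p)
    ⌊_⌋ {p} (nonNeg 0≤) with ⟦ p ⟧P (ℤ.+ b ∷ η) in eq
    ⌊_⌋ {p} (nonNeg (ℤ.+≤+ _)) | ℤ.+ m = c (subst (λ x → NonNegative ⟨ x , ℤ.+ 0 , ℤ.+ 0 ⟩) (sym eq) (ℕ-nonneg m))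

    normalise≡⇒≡ : ∀ p p′ → normalise p ≡ normalise p′ → ⟦ p ⟧P (ℤ.+ b ∷ η) ≡ ⟦ p′ ⟧P (ℤ.+ b ∷ η)
    normalise≡⇒≡ p p′ eq = trans (sym (correct p (ℤ.+ b ∷ η)))
      (trans (cong (λ m → ⟦ m ⟧N (ℤ.+ b ∷ η)) eq) (correct p′ (ℤ.+ b ∷ η)))

    squeeze : ∀ {p p′} → NonNeg η p → NonNeg η p′ → ∀ d e →
      normalise p ≡ normalise (d :- e) → normalise p′ ≡ normalise (e :- d) →
      ⟦ d ⟧P (ℤ.+ b ∷ η) ≡ ⟦ e ⟧P (ℤ.+ b ∷ η)
    squeeze {p} {p′} (nonNeg 0≤p) (nonNeg 0≤p′) d e eq eq′ = ℤ.≤-antisym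
      (ℤ.0≤i-j⇒j≤i (subst (ℤ.+ 0 ℤ.≤_) (normalise≡⇒≡ p′ (e :- d) eq′) 0≤p′))
      (ℤ.0≤i-j⇒j≤i (subst (ℤ.+ 0 ℤ.≤_) (normalise≡⇒≡ p (d :- e) eq) 0≤p))

    infixl 5 _⊙_

    -- (1 + d)(1 + e) - 1
    _⊙_ : ∀ {σ τ d e} → Signed σ η d → Signed τ η e → Signed (σ ∨ τ ∨ (σ ∧ τ)) η (d ⊞ (e ⊞ d ⊠ e))
    x ⊙ y = x ⊹ (y ⊹ x ⋆ y)

    1-product : ∀ d e f {x y z} → ⟪ d ⟫ {b} η ≡ x → ⟪ e ⟫ η ≡ y → ⟪ f ⟫ η ≡ z → x ⊗ y ⊗ z ≡ 1ρ →
      NonNegative (⟪ 1̲ ⊞ -1̲ ⊡ (d ⊠ e ⊠ f) ⟫ η)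
    1-product _ _ _ refl refl refl eq = zero (cong (λ α → 1ρ ⊕ (ℤ.- ℤ.+ 1) • α) eq)

  -- The coordinates are polynomials, so that normal forms see special values such as k = -1 or j =
  -- a + 1 - k.
  module Element {n : ℕ} (η : Vec ℤ n) (i j k : Polynomial (suc n))
    (h : SmallUnit (fromIJK (⟦ i ⟧P (ℤ.+ b ∷ η)) (⟦ j ⟧P (ℤ.+ b ∷ η)) (⟦ k ⟧P (ℤ.+ b ∷ η)))) where
    open SmallUnit h

    x₀ x₁ x₂ g₀ g₁ g₂ : Polynomial (suc n)
    x₀ = i :+ j :+ k :* (a̲ :+ num 2)
    x₁ = j :+ k :* a̲
    x₂ = :- k
    g₀ = (a̲ :* a̲ :+ a̲ :+ num 8) :+ -1̲ :* x₀
    g₁ = (a̲ :* a̲ :- a̲ :+ num 1) :+ -1̲ :* x₁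
    g₂ = (num 2 :- a̲) :+ -1̲ :* x₂

    X Y Z : Exp n
    X = tri x₀ x₁ x₂
    Y = conj̲ ρ′̲ x₀ x₁ x₂
    Z = conj̲ ρ″̲ x₀ x₁ x₂

    hx : Signed true η X
    hx = c x>0
    hy : Signed true η Y
    hy = c y>0
    hz : Signed true η Z
    hz = c z>0
    gx : Signed false η (tri g₀ g₁ g₂)
    gx = c x≤
    gy : Signed false η (conj̲ ρ′̲ g₀ g₁ g₂)
    gy = c y≤
    gz : Signed false η (conj̲ ρ″̲ g₀ g₁ g₂)
    gz = c z≤
    unit : Signed false η (1̲ ⊞ -1̲ ⊡ (X ⊠ Y ⊠ Z))
    unit = c (1-product X Y Z {ε} {conj ρ′ᵉ ε} {conj ρ″ᵉ ε} refl refl refl xyz≡1)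
      where
      ε : ℤ[ρ] (7+ b)
      ε = fromIJK (⟦ i ⟧P (ℤ.+ b ∷ η)) (⟦ j ⟧P (ℤ.+ b ∷ η)) (⟦ k ⟧P (ℤ.+ b ∷ η))

    -- `e` equals xyz - 1. It is built with `_⊙_` from the amounts by which factors of xyz exceed 1;
    -- a factor is one of x, y, z or a product of them, times powers of ρ and 1 + ρ that cancel
    -- overall.
    xyz>1 : ∀ {e} → Signed true η e → norm ((1̲ ⊞ -1̲ ⊡ (X ⊠ Y ⊠ Z)) ⊞ e) ≡ norm {n} 0̲ → ⊥
    xyz>1 e eq = refute unit e refl eq

  OneOrρ² : ℤ → ℤ → ℤ → Set
  OneOrρ² i j k = (i ≡ ℤ.+ 1 × j ≡ ℤ.+ 0 × k ≡ ℤ.+ 0) ⊎ (i ≡ ℤ.+ 2 × j ≡ 7+ b × k ≡ ℤ.- ℤ.+ 1)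

  module _ {i j k : ℤ} where

    private
      I J K : Polynomial 4
      I = v (# 0)
      J = v (# 1)
      K = v (# 2)

      η : Vec ℤ 3
      η = i ∷ j ∷ k ∷ []

      -- The integer q in ρ y = q + i (s + t) + k s.
      quotient : Polynomial 4
      quotient = I :* (a̲ :+ num 1) :- J :- K

    module _ (h : SmallUnit (fromIJK i j k)) where

      open Element η I J K h

      -- If i ≥ a + 3 + k, the bound on y fails; otherwise x ≤ a + 2 - (1 + ρ) = -s - t.
      j<0≤k : NonNeg η (-1̲ :- J) → NonNeg η K → ⊥
      j<0≤k -1-j k≥0 with split (I :- (a̲ :+ num 3 :+ K))
      ... | inj₁ i′ = refute gy
        -- Uses s ρ = 1 - s and s t (a + s) = (a + 2) t - 1.
        (b′ ⊹ ⌊ k≥0 ⌋ ⋆ s⁺ ⋆ ρ⁺ ⊹ ⌊ i′ ⌋ ⊹ ⌊ -1-j ⌋ ⋆ t⁺ ⊹ t⁺ ⋆ s⁺ ⋆ (a′ ⊹ s⁺) ⊹ (lit 5 ⊹ b′) ⋆ s⁺) refl refl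
      ... | inj₂ i′ = refute hx
        (⌊ i′ ⌋ ⊹ s⁺ ⊹ t⁺ ⊹ ⌊ -1-j ⌋ ⋆ (one ⊹ ρ⁺) ⊹ ⌊ k≥0 ⌋ ⋆ t⁺) refl refl

      -- If i ≥ a + 3, the bound on y fails; otherwise z ≤ a + 2 - s ρ - ρ = -t.
      j<0,k<0 : NonNeg η (-1̲ :- J) → NonNeg η (-1̲ :- K) → ⊥
      j<0,k<0 j′ k′ with split (I :- (a̲ :+ num 3))
      ... | inj₁ i′ = refute gy
        (b′ ⊹ ⌊ i′ ⌋ ⊹ ⌊ j′ ⌋ ⋆ t⁺ ⊹ ⌊ k′ ⌋ ⋆ s⁺ ⊹ t⁺ ⋆ s⁺ ⋆ (a′ ⊹ s⁺) ⊹ (lit 6 ⊹ b′) ⋆ s⁺) refl refl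
      ... | inj₂ i′ = refute hz
        (⌊ i′ ⌋ ⊹ t⁺ ⊹ ⌊ j′ ⌋ ⋆ s⁺ ⋆ ρ⁺ ⊹ ⌊ k′ ⌋ ⋆ ρ⁺) refl refl

      -- For j > a, adding γ - x and z eliminates i. For j ≤ a, z > 0 needs i ≥ 2 a + 3 - j, where
      -- the bound on y fails unless j = a and i = a + 3.
      j≥0,k<-1 : NonNeg η J → NonNeg η (con (ℤ.- ℤ.+ 2) :- K) → ⊥
      j≥0,k<-1 j≥0 k′ with split (J :- (a̲ :+ num 1))
      ... | inj₁ J′ = refute (gx ⊹ hz)
        (lit 4 ⊹ lit 2 ⋆ b′ ⊹ a′ ⋆ t⁺ ⊹ (a′ ⊹ lit 3) ⋆ s⁺ ⊹ lit 2 ⋆ t⁺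
          ⊹ ⌊ J′ ⌋ ⋆ (ρ⁺ ⊹ s⁺) ⊹ ⌊ k′ ⌋ ⋆ (one ⊹ t⁺ ⊹ ρ⁺)) refl refl
      ... | inj₂ j′ with split (I :- (a̲ :+ num 3 :+ (a̲ :- J)))
      ... | inj₂ i′ = refute hz
        (⌊ i′ ⌋ ⊹ ⌊ j≥0 ⌋ ⋆ s⁺ ⊹ lit 2 ⋆ s⁺ ⊹ lit 2 ⋆ t⁺ ⊹ ⌊ k′ ⌋ ⋆ ρ⁺) refl refl
      ... | inj₁ i′ with split (a̲ :- num 1 :- J)
      ... | inj₁ j″ = refute gy
        (b′ ⊹ ⌊ j″ ⌋ ⊹ ⌊ i′ ⌋ ⊹ (lit 2 ⊹ ⌊ j″ ⌋) ⋆ t⁺ ⊹ (a′ ⊹ ⌊ k′ ⌋) ⋆ s⁺) refl refl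
      ... | inj₂ m with split (I :- (a̲ :+ num 4 :+ (a̲ :- J)))
      ... | inj₁ i″ = refute gy
        (b′ ⊹ ⌊ j′ ⌋ ⊹ ⌊ i″ ⌋ ⊹ (one ⊹ ⌊ j′ ⌋) ⋆ t⁺ ⊹ (a′ ⊹ ⌊ k′ ⌋) ⋆ s⁺) refl refl
      ... | inj₂ e = refute hz
        -- In the case left over z ≤ 1 - (a + 2) s - 2 t = -s (2 + s t), by 1 = s (a + 2 + s + t)
        -- and t - s = s t.
        (⌊ e ⌋ ⊹ ⌊ m ⌋ ⋆ s⁺ ⊹ s⁺ ⋆ (lit 2 ⊹ s⁺ ⋆ t⁺) ⊹ ⌊ k′ ⌋ ⋆ ρ⁺) refl refl

      i>0 : NonNeg η J → NonNeg η K → NonNeg η (I :- num 1)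
      i>0 j≥0 k≥0 with split (I :- num 1)
      ... | inj₁ i′ = i′
      ... | inj₂ i′ = ⊥-elim (refute hy (⌊ i′ ⌋ ⊹ ⌊ j≥0 ⌋ ⋆ t⁺ ⊹ ⌊ k≥0 ⌋ ⋆ s⁺) refl refl)

      -- Suppose j ≥ a + 2. For i ≤ 1, y is negative because (a + 2) t > 1. For i ≥ 2 the bound on z
      -- fails if k ≥ a - 1, and the bound on x if k ≤ a - 2.
      j≤a+1 : NonNeg η K → NonNeg η (I :- num 1) → NonNeg η (a̲ :+ num 1 :- J)
      j≤a+1 k≥0 i′ with split (a̲ :+ num 1 :- J)
      ... | inj₁ j′ = j′
      ... | inj₂ J′ with split (I :- num 2)
      ... | inj₂ e = ⊥-elim (refute hy
        (⌊ e ⌋ ⊹ ⌊ J′ ⌋ ⋆ t⁺ ⊹ ⌊ k≥0 ⌋ ⋆ s⁺ ⊹ t⁺ ⋆ s⁺ ⋆ (a′ ⊹ s⁺)) refl refl)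
      ... | inj₁ i″ with split (K :- (a̲ :- num 1))
      ... | inj₁ K′ = ⊥-elim (refute gz
        (⌊ i″ ⌋ ⊹ b′ ⊹ t⁺ ⊹ ⌊ J′ ⌋ ⋆ s⁺ ⋆ ρ⁺ ⊹ ⌊ K′ ⌋ ⋆ ρ⁺) refl refl)
      ... | inj₂ K′ = ⊥-elim (refute gx
        (⌊ i″ ⌋ ⊹ b′ ⊹ s⁺ ⊹ t⁺ ⊹ ⌊ J′ ⌋ ⋆ (one ⊹ ρ⁺) ⊹ ⌊ K′ ⌋ ⋆ (one ⊹ t⁺)) refl refl)

      -- Suppose k ≥ a. The bound on z fails for j ≥ 1, and for j = 0 if i > k; otherwise x ≤ -k t.
      k≤a-1 : NonNeg η J → NonNeg η K → NonNeg η (I :- num 1) → NonNeg η (a̲ :+ num 1 :- J) →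
        NonNeg η (a̲ :- num 1 :- K)
      k≤a-1 j≥0 k≥0 i′ j′ with split (a̲ :- num 1 :- K)
      ... | inj₁ k′ = k′
      ... | inj₂ K′ with split (J :- num 1)
      ... | inj₁ d with split (J :- num 2)
      ...   | inj₁ d′ = ⊥-elim (refute gz
        (⌊ i′ ⌋ ⊹ b′ ⊹ ⌊ d′ ⌋ ⊹ ⌊ j′ ⌋ ⋆ s⁺ ⊹ lit 2 ⋆ s⁺ ⊹ lit 2 ⋆ t⁺ ⊹ ⌊ K′ ⌋ ⋆ ρ⁺) refl refl)
      ...   | inj₂ e = ⊥-elim (refute gz
        -- For j = 1 there remains 1 - b - (a + 2) s - 2 t, negative since 1 - (a + 2) s - 2 t = -s
        -- (2 + s t).
        (⌊ i′ ⌋ ⊹ b′ ⊹ ⌊ d ⌋ ⊹ ⌊ e ⌋ ⋆ s⁺ ⊹ s⁺ ⋆ (lit 2 ⊹ s⁺ ⋆ t⁺) ⊹ ⌊ K′ ⌋ ⋆ ρ⁺) refl refl)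
      k≤a-1 j≥0 k≥0 i′ j′ | inj₂ K′ | inj₂ l with split (I :- K :- num 1)
      ... | inj₁ i₂ = ⊥-elim (refute gz
        (lit 5 ⊹ lit 2 ⋆ b′ ⊹ ⌊ K′ ⌋ ⊹ ⌊ i₂ ⌋ ⊹ (a′ ⊹ lit 3) ⋆ s⁺ ⊹ lit 2 ⋆ t⁺ ⊹ ⌊ K′ ⌋ ⋆ ρ⁺ ⊹ ⌊ j≥0 ⌋ ⋆ s⁺ ⋆ ρ⁺) refl refl)
      ... | inj₂ e = ⊥-elim (refute hx (⌊ e ⌋ ⊹ ⌊ l ⌋ ⋆ (one ⊹ ρ⁺) ⊹ ⌊ k≥0 ⌋ ⋆ t⁺) refl refl)

      -- The factors are ρ y, z / ρ = k + i t + j s and x; they exceed 1 by q ≥ 1, by k ≥ 1, and by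
      -- j ≥ 1 with k ≤ a - 1.
      j>0,k>0,q>0 : NonNeg η (I :- num 1) → NonNeg η (J :- num 1) → NonNeg η (K :- num 1) →
        NonNeg η (a̲ :- num 1 :- K) → NonNeg η (quotient :- num 1) → ⊥
      j>0,k>0,q>0 i′ d κ k′ q′ = xyz>1
        (⌊ q′ ⌋ ⊹ (one ⊹ ⌊ i′ ⌋) ⋆ (s⁺ ⊹ t⁺) ⊹ (one ⊹ ⌊ κ ⌋) ⋆ s⁺
          ⊙ ⌊ κ ⌋ ⊹ (one ⊹ ⌊ i′ ⌋) ⋆ t⁺ ⊹ (one ⊹ ⌊ d ⌋) ⋆ s⁺
          ⊙ ⌊ i′ ⌋ ⊹ ⌊ d ⌋ ⋆ (one ⊹ ρ⁺) ⊹ ⌊ k′ ⌋ ⋆ (one ⊹ t⁺) ⊹ lit 2 ⊹ s⁺ ⊹ t⁺ ⊹ t⁺ ⋆ (lit 2 ⊹ s⁺ ⊹ t⁺)) refl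

      -- For i ≥ 2, q ≥ 2 (a + 1) - (a + 1) - (a - 1) = 2.
      q≤0⇒i≤1 : NonNeg η (a̲ :+ num 1 :- J) → NonNeg η (a̲ :- num 1 :- K) →
        NonNeg η (-1̲ :- (quotient :- num 1)) → NonNeg η (num 1 :- I)
      q≤0⇒i≤1 j′ k′ m with split (num 1 :- I)
      ... | inj₁ e = e
      ... | inj₂ i″ = ⊥-elim (refute ⌊ m ⌋ (⌊ i″ ⌋ ⋆ (a′ ⊹ one) ⊹ lit 2 ⊹ ⌊ j′ ⌋ ⊹ ⌊ k′ ⌋) refl refl)

      q≤0⇒j+k≥a+1 : NonNeg η (I :- num 1) → NonNeg η (-1̲ :- (quotient :- num 1)) → NonNeg η (J :+ K :- (a̲ :+ num 1))
      q≤0⇒j+k≥a+1 i′ m with split (J :+ K :- (a̲ :+ num 1))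
      ... | inj₁ m′ = m′
      ... | inj₂ e = ⊥-elim (refute ⌊ m ⌋ (⌊ i′ ⌋ ⋆ (a′ ⊹ one) ⊹ one ⊹ ⌊ e ⌋) refl refl)

    module _ (h : SmallUnit (fromIJK i j (ℤ.- ℤ.+ 1))) where

      open Element η I J -1̲ h

      -- For j ≥ a + 2, adding γ - x and y eliminates i. For smaller j, z > 0 gives n = i + j - a -
      -- 2 ≥ 0, and xyz = 1 leaves n = 0 with j = a or j = a + 1.
      j≥0,k=-1 : NonNeg η J → i ≡ ℤ.+ 2 × j ≡ 7+ b
      j≥0,k=-1 j≥0 with split (J :- (a̲ :+ num 2))
      ... | inj₁ J′ = ⊥-elim (refute (gx ⊹ hy)
        (lit 4 ⊹ lit 2 ⋆ b′ ⊹ (lit 2 ⋆ a′ ⊹ lit 2) ⋆ t⁺ ⊹ ⌊ J′ ⌋ ⋆ (one ⊹ ρ⁺ ⊹ t⁺)) refl refl)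
      ... | inj₂ j′ with split (I :- (a̲ :+ num 1 :- J) :- num 1)
      ... | inj₂ i′ = ⊥-elim (refute hz (⌊ i′ ⌋ ⊹ ⌊ j≥0 ⌋ ⋆ s⁺ ⊹ s⁺ ⊹ t⁺) refl refl)
      ... | inj₁ n with split (a̲ :- num 1 :- J)
      ... | inj₁ j″ = ⊥-elim (xyz>1
        -- The factors, here and for j ≥ a below, are s x, (1 + ρ) z = n (1 + ρ) + a - j + s and y.
        (s⁺ ⋆ (s⁺ ⋆ ρ⁺ ⊹ ⌊ j≥0 ⌋ ⋆ ρ⁺ ⊹ ⌊ n ⌋)
          ⊙ ⌊ n ⌋ ⋆ (one ⊹ ρ⁺) ⊹ ⌊ j″ ⌋ ⊹ s⁺
          ⊙ one ⊹ ⌊ j″ ⌋ ⊹ ⌊ n ⌋ ⊹ s⁺ ⊹ t⁺ ⋆ (lit 2 ⊹ s⁺ ⊹ t⁺) ⊹ ⌊ j″ ⌋ ⋆ t⁺) refl)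
      ... | inj₂ m with split (I :- (a̲ :+ num 1 :- J) :- num 2)
      ... | inj₁ n′ = ⊥-elim (xyz>1
        (s⁺ ⋆ (s⁺ ⋆ ρ⁺ ⊹ ⌊ j≥0 ⌋ ⋆ ρ⁺ ⊹ one ⊹ ⌊ n′ ⌋)
          ⊙ ⌊ n′ ⌋ ⋆ (one ⊹ ρ⁺) ⊹ ⌊ j′ ⌋ ⊹ s⁺ ⊹ (a′ ⊹ s⁺ ⊹ t⁺)
          ⊙ ⌊ j′ ⌋ ⊹ ⌊ n′ ⌋ ⊹ t⁺ ⋆ (s⁺ ⊹ t⁺) ⊹ ⌊ j′ ⌋ ⋆ t⁺ ⊹ s⁺) refl)
      ... | inj₂ e with split (J :- (a̲ :+ num 1))
      -- With n = 0 and j = a + 1, z = 1 - (a + 2) s - t = -s² ρ.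
      ... | inj₁ l = ⊥-elim (refute hz (⌊ e ⌋ ⊹ ⌊ l ⌋ ⋆ s⁺ ⊹ s⁺ ⋆ s⁺ ⋆ ρ⁺) refl refl)
      ... | inj₂ l = i≡2 , j≡a
        where
        j≡a : j ≡ 7+ b
        j≡a = squeeze m l J a̲ refl refl
        i≡2 : i ≡ ℤ.+ 2
        i≡2 = trans (squeeze n e I (a̲ :+ num 2 :- J) refl refl)
          (trans (cong (λ x → 7+ b ℤ.+ ℤ.+ 2 ℤ.- x) j≡a) (identity (7+ b)))
          where
          identity : ∀ x → x ℤ.+ ℤ.+ 2 ℤ.- x ≡ ℤ.+ 2
          identity = solve 1 (λ x → x :+ num 2 :- x := num 2) refl

    module _ (h : SmallUnit (fromIJK i (ℤ.+ 0) (ℤ.+ 0))) where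

      open Element η I (num 0) (num 0) h

      j=k=0 : NonNeg η (I :- num 1) → i ≡ ℤ.+ 1
      j=k=0 i′ with split (I :- num 2)
      ... | inj₁ i″ = ⊥-elim (xyz>1 (one ⊹ ⌊ i″ ⌋ ⊙ one ⊹ ⌊ i″ ⌋ ⊙ one ⊹ ⌊ i″ ⌋) refl)
      ... | inj₂ e = squeeze i′ e I (num 1) refl refl

    module _ (h : SmallUnit (fromIJK i (ℤ.+ 0) k)) where

      open Element η I (num 0) K h

      -- If i ≤ k, then x ≤ -k t. Otherwise the factors ρ x, z / ρ and y exceed 1, by k ≤ a - 1, k ≥
      -- 1 and i > k.
      j=0<k : NonNeg η (K :- num 1) → NonNeg η (a̲ :- num 1 :- K) → ⊥
      j=0<k κ k′ with split (I :- K :- num 1)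
      ... | inj₂ e = refute hx (⌊ e ⌋ ⊹ (one ⊹ ⌊ κ ⌋) ⋆ t⁺) refl refl
      ... | inj₁ i′ = xyz>1
        (⌊ k′ ⌋ ⊹ one ⊹ s⁺ ⊹ t⁺ ⊹ ⌊ i′ ⌋ ⋆ ρ⁺
          ⊙ ⌊ κ ⌋ ⊹ (⌊ i′ ⌋ ⊹ ⌊ κ ⌋ ⊹ lit 2) ⋆ t⁺
          ⊙ ⌊ i′ ⌋ ⊹ (one ⊹ ⌊ κ ⌋) ⋆ s⁺ ⋆ ρ⁺) refl

    module _ (h : SmallUnit (fromIJK i j (ℤ.+ 0))) where

      open Element η I J (num 0) h

      -- The factors are ρ y, x / ρ = j + (i + j) t and z.
      k=0<j,q>0 : NonNeg η (I :- num 1) → NonNeg η (J :- num 1) → NonNeg η K → NonNeg η (quotient :- num 1) → ⊥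
      k=0<j,q>0 i′ d k≥0 q′ = xyz>1
        -- `quotient` subtracts the variable k, whereas the third coordinate is the constant 0;
        -- `k≥0` adds k back.
        (⌊ q′ ⌋ ⊹ ⌊ k≥0 ⌋ ⊹ (one ⊹ ⌊ i′ ⌋) ⋆ (s⁺ ⊹ t⁺)
          ⊙ ⌊ d ⌋ ⊹ (lit 2 ⊹ ⌊ i′ ⌋ ⊹ ⌊ d ⌋) ⋆ t⁺
          ⊙ ⌊ i′ ⌋ ⊹ (one ⊹ ⌊ d ⌋) ⋆ s⁺ ⋆ ρ⁺) refl

    module _ (h : SmallUnit (fromIJK (ℤ.+ 1) (7+ b ℤ.+ ℤ.+ 1 ℤ.- ℤ.+ 0) (ℤ.+ 0))) where

      open Element η (num 1) (a̲ :+ num 1 :- num 0) (num 0) h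

      -- Here y = 1 - (a + 1) t = t (s + t) is small and is paired with x: the factors are x y and
      -- z.
      i=1,j=a+1,k=0 : ⊥
      i=1,j=a+1,k=0 = xyz>1
        (s⁺ ⋆ (lit 6 ⊹ b′ ⊹ s⁺ ⋆ ρ⁺) ⊹ a′ ⋆ s⁺ ⋆ t⁺ ⊹ (a′ ⊹ lit 2) ⋆ t⁺ ⋆ (s⁺ ⊹ t⁺)
          ⊙ (a′ ⊹ one) ⋆ s⁺ ⋆ ρ⁺) refl

    module _ (h : SmallUnit (fromIJK (ℤ.+ 1) (7+ b ℤ.+ ℤ.+ 1 ℤ.- k) k)) where

      open Element η (num 1) (a̲ :+ num 1 :- K) K h

      -- Since y = s t (k + 2 + t), the factors are s x, ρ (1 + ρ) y and z / ρ.
      i=1,j+k=a+1,k>0 : NonNeg η (K :- num 1) → NonNeg η (a̲ :- num 1 :- K) → ⊥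
      i=1,j+k=a+1,k>0 κ d = xyz>1
        (s⁺ ⋆ (lit 3 ⊹ s⁺ ⊹ t⁺ ⊹ t⁺ ⋆ (lit 2 ⊹ s⁺ ⊹ t⁺) ⊹ ⌊ d ⌋ ⋆ (one ⊹ ρ⁺) ⊹ ⌊ d ⌋ ⋆ (one ⊹ t⁺))
          ⊙ one ⊹ t⁺ ⊹ one ⊹ ⌊ κ ⌋
          ⊙ ⌊ κ ⌋ ⊹ t⁺ ⊹ (lit 2 ⊹ ⌊ d ⌋) ⋆ s⁺) refl

    module _ (h : SmallUnit (fromIJK (ℤ.+ 1) j k)) where

      open Element η (num 1) J K h

      -- From q ≤ -1 and k ≤ a - 1, ρ y = q + s + t + k s ≤ -s (1 + s).
      i=1,j+k>a+1 : NonNeg η (a̲ :- num 1 :- K) → NonNeg η (J :+ K :- (a̲ :+ num 2)) → ⊥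
      i=1,j+k>a+1 k′ q′ = refute (hy ⋆ ρ⁺) (⌊ q′ ⌋ ⊹ s⁺ ⋆ (one ⊹ s⁺) ⊹ ⌊ k′ ⌋ ⋆ s⁺) refl refl

      i=1,j+k≥a+1 : NonNeg η K → NonNeg η (a̲ :- num 1 :- K) → NonNeg η (J :+ K :- (a̲ :+ num 1)) → ⊥
      i=1,j+k≥a+1 k≥0 k′ m with split (J :+ K :- (a̲ :+ num 2))
      ... | inj₁ q′ = i=1,j+k>a+1 k′ q′
      ... | inj₂ e with split (K :- num 1)
      ...   | inj₁ κ = i=1,j+k=a+1,k>0
        (subst (λ x → SmallUnit (fromIJK (ℤ.+ 1) x k)) (squeeze m e J (a̲ :+ num 1 :- K) refl refl) h) κ k′
      ...   | inj₂ k≤0 = i=1,j=a+1,k=0 (subst (λ x → SmallUnit (fromIJK (ℤ.+ 1) (7+ b ℤ.+ ℤ.+ 1 ℤ.- x) x))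
        (squeeze k≥0 k≤0 K (num 0) refl refl)
        (subst (λ x → SmallUnit (fromIJK (ℤ.+ 1) x k)) (squeeze m e J (a̲ :+ num 1 :- K) refl refl) h))

    module _ (h : SmallUnit (fromIJK i j k)) where

      j>0,k≥0 : NonNeg η (I :- num 1) → NonNeg η (J :- num 1) → NonNeg η K →
        NonNeg η (a̲ :+ num 1 :- J) → NonNeg η (a̲ :- num 1 :- K) → ⊥
      j>0,k≥0 i′ d k≥0 j′ k′ with split (quotient :- num 1)
      ... | inj₂ q≤0 = i=1,j+k≥a+1
        (subst (λ x → SmallUnit (fromIJK x j k)) (squeeze i′ (q≤0⇒i≤1 h j′ k′ q≤0) I (num 1) refl refl) h)
        k≥0 k′ (q≤0⇒j+k≥a+1 h i′ q≤0)
      ... | inj₁ q′ with split (K :- num 1)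
      ...   | inj₁ κ = j>0,k>0,q>0 h i′ d κ k′ q′
      ...   | inj₂ k≤0 = k=0<j,q>0
        (subst (λ x → SmallUnit (fromIJK i j x)) (squeeze k≥0 k≤0 K (num 0) refl refl) h) i′ d k≥0 q′

      j≥0,k≥0 : NonNeg η J → NonNeg η K → OneOrρ² i j k
      j≥0,k≥0 j≥0 k≥0 with split (J :- num 1)
      ... | inj₁ d = ⊥-elim (j>0,k≥0 i′ d k≥0 j′ (k≤a-1 h j≥0 k≥0 i′ j′))
        where
        i′ = i>0 h j≥0 k≥0
        j′ = j≤a+1 h k≥0 i′
      ... | inj₂ j≤0 with squeeze j≥0 j≤0 J (num 0) refl refl | split (K :- num 1)
      ...   | j≡0 | inj₁ κ = ⊥-elim (j=0<k (subst (λ x → SmallUnit (fromIJK i x k)) j≡0 h) κ (k≤a-1 h j≥0 k≥0 i′ j′))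
        where
        i′ = i>0 h j≥0 k≥0
        j′ = j≤a+1 h k≥0 i′
      ...   | j≡0 | inj₂ k≤0 = inj₁ (j=k=0 (subst₂ (λ x y → SmallUnit (fromIJK i x y)) j≡0 k≡0 h) (i>0 h j≥0 k≥0) , j≡0 , k≡0)
        where
        k≡0 : k ≡ ℤ.+ 0
        k≡0 = squeeze k≥0 k≤0 K (num 0) refl refl

      j≥0,k<0 : NonNeg η J → NonNeg η (-1̲ :- K) → OneOrρ² i j k
      j≥0,k<0 j≥0 k<0 with split (con (ℤ.- ℤ.+ 2) :- K)
      ... | inj₁ k′ = ⊥-elim (j≥0,k<-1 h j≥0 k′)
      ... | inj₂ e = inj₂ (proj₁ i≡2,j≡a , proj₂ i≡2,j≡a , k≡-1)
        where
        k≡-1 : k ≡ ℤ.- ℤ.+ 1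
        k≡-1 = squeeze e k<0 K -1̲ refl refl
        i≡2,j≡a : i ≡ ℤ.+ 2 × j ≡ 7+ b
        i≡2,j≡a = j≥0,k=-1 (subst (λ x → SmallUnit (fromIJK i j x)) k≡-1 h) j≥0

      classify : OneOrρ² i j k
      classify with split J | split K
      ... | inj₁ j≥0 | inj₁ k≥0 = j≥0,k≥0 j≥0 k≥0
      ... | inj₁ j≥0 | inj₂ k<0 = j≥0,k<0 j≥0 k<0
      ... | inj₂ j<0 | inj₁ k≥0 = ⊥-elim (j<0≤k h j<0 k≥0)
      ... | inj₂ j<0 | inj₂ k<0 = ⊥-elim (j<0,k<0 h j<0 k<0)

-- From totally positive units below γ to the classification

module _ (b : ℕ) (R : Roots (7+ b)) where
  open Roots R
  open Order b R
  open Classification b R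
  open Conjugates R

  ¬Positive-negative : ∀ m → Positive ⟨ ℤ.-[1+ m ] , ℤ.+ 0 , ℤ.+ 0 ⟩ → ⊥
  ¬Positive-negative m p = ¬Positive-0 (subst Positive (cong (λ x → ⟨ x , ℤ.+ 0 , ℤ.+ 0 ⟩) (ℤ.+-inverseˡ (ℤ.+ suc m))) (Positive-⊕ p (ℕ-pos m)))

  -- The norms of α and of its inverse are integers with product 1, and positivity excludes -1.
  unit⇒N≡1 : ∀ α β → α ⊗ β ≡ 1ρ → Positive (N α) → N α ≡ 1ρ
  unit⇒N≡1 α β αβ≡1 Nα>0 = trans (N-rational α) (cong (λ x → ⟨ x , ℤ.+ 0 , ℤ.+ 0 ⟩)
    (m≡1 (ℤ[ρ].c₀ (N α)) (subst Positive (N-rational α) Nα>0) mn≡1))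
    where
    m n : ℤ
    m = ℤ[ρ].c₀ (N α)
    n = ℤ[ρ].c₀ (N β)
    mn≡1 : m ℤ.* n ≡ ℤ.+ 1
    mn≡1 = cong ℤ[ρ].c₀ (begin
      ⟨ m ℤ.* n , ℤ.+ 0 , ℤ.+ 0 ⟩
        ≡⟨ decide (m ∷ n ∷ []) (tri (v (# 0) :* v (# 1)) (num 0) (num 0)) (int (v (# 0)) ⊠ int (v (# 1))) refl ⟩
      ⟨ m , ℤ.+ 0 , ℤ.+ 0 ⟩ ⊗ ⟨ n , ℤ.+ 0 , ℤ.+ 0 ⟩
        ≡⟨ cong₂ _⊗_ (N-rational α) (N-rational β) ⟨
      N α ⊗ N β
        ≡⟨ N-⊗-inverse α β αβ≡1 ⟩
      1ρ ∎)
      where open ≡-Reasoning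
    m≡1 : ∀ m → Positive ⟨ m , ℤ.+ 0 , ℤ.+ 0 ⟩ → m ℤ.* n ≡ ℤ.+ 1 → m ≡ ℤ.+ 1
    m≡1 (ℤ.+ m) _ eq = cong ℤ.+_ (ℕ.m*n≡1⇒m≡1 m ℤ.∣ n ∣ (trans (sym (ℤ.abs-* (ℤ.+ m) n)) (cong ℤ.∣_∣ eq)))
    m≡1 ℤ.-[1+ m ] p _ = ⊥-elim (¬Positive-negative m p)

  conj′-pos : ∀ α → Pos (α at ρ′) → Positive (conj ρ′ᵉ α)
  conj′-pos = conj-pos ρ′ᵉ ρ′ ρ′≈

  conj″-pos : ∀ α → Pos (α at ρ″) → Positive (conj ρ″ᵉ α)
  conj″-pos = conj-pos ρ″ᵉ ρ″ ρ″≈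

  ⊖-self : ∀ (α : ℤ[ρ] (7+ b)) → α ⊖ α ≡ 0ρ
  ⊖-self ⟨ u , v′ , w ⟩ = decide (u ∷ v′ ∷ w ∷ [])
    (α ⊞ -1̲ ⊡ α) 0̲ refl
    where
    α : Exp 3
    α = tri (v (# 0)) (v (# 1)) (v (# 2))

  smallUnit : ∀ ε → TotallyPositive ε → IsUnit ε → γ (7+ b) ⪰ ε → SmallUnit ε
  smallUnit ε (x , y , z) (β , _ , εβ≡1) γ⪰ε = record
    { x>0 = x>0
    ; y>0 = y>0
    ; z>0 = z>0
    ; x≤ = proj₁ (bounds γ⪰ε)
    ; y≤ = proj₁ (proj₂ (bounds γ⪰ε))
    ; z≤ = proj₂ (proj₂ (bounds γ⪰ε))
    ; xyz≡1 = unit⇒N≡1 ε β εβ≡1 (Positive-⊗ (Positive-⊗ x>0 y>0) z>0)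
    }
    where
    x>0 : Positive ε
    x>0 = mkP (0<ℝ⇒pos ε ρ x)
    y>0 : Positive (conj ρ′ᵉ ε)
    y>0 = conj′-pos ε (0<ℝ⇒pos ε ρ′ y)
    z>0 : Positive (conj ρ″ᵉ ε)
    z>0 = conj″-pos ε (0<ℝ⇒pos ε ρ″ z)
    δ : ℤ[ρ] (7+ b)
    δ = γ (7+ b) ⊖ ε
    bounds : γ (7+ b) ⪰ ε → NonNegative δ × NonNegative (conj ρ′ᵉ δ) × NonNegative (conj ρ″ᵉ δ)
    bounds (inj₁ (x< , y< , z<)) =
      pos (mkP (<ℝ⇒⊖-pos (γ (7+ b)) ε ρ x<)) ,
      pos (conj′-pos δ (<ℝ⇒⊖-pos (γ (7+ b)) ε ρ′ y<)) ,
      pos (conj″-pos δ (<ℝ⇒⊖-pos (γ (7+ b)) ε ρ″ z<))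
    bounds (inj₂ γ≡ε) = zero δ≡0 ,
      zero (trans (cong (conj ρ′ᵉ) δ≡0) (decide [] (conj̲ ρ′̲ (num 0) (num 0) (num 0)) 0̲ refl)) ,
      zero (trans (cong (conj ρ″ᵉ) δ≡0) (decide [] (conj̲ ρ″̲ (num 0) (num 0) (num 0)) 0̲ refl))
      where
      δ≡0 : δ ≡ 0ρ
      δ≡0 = trans (cong (_⊖ ε) γ≡ε) (⊖-self ε)

  ijk-coordinates : ∀ (ε : ℤ[ρ] (7+ b)) → ∃[ i ] ∃[ j ] ∃[ k ] ε ≡ fromIJK i j k
  ijk-coordinates ⟨ u , v′ , w ⟩ =
    u ℤ.- (v′ ℤ.+ w ℤ.* 7+ b) ℤ.+ w ℤ.* (7+ b ℤ.+ ℤ.+ 2) , v′ ℤ.+ w ℤ.* 7+ b , ℤ.- w ,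
    decide (u ∷ v′ ∷ w ∷ []) (tri U V W) (tri (i :+ j :+ k :* (a̲ :+ num 2)) (j :+ k :* a̲) (:- k)) refl
    where
    U V W i j k : Polynomial 4
    U = v (# 0)
    V = v (# 1)
    W = v (# 2)
    k = :- W
    j = V :+ W :* a̲
    i = U :- j :+ W :* (a̲ :+ num 2)

  OneOrρ²⇒ : ∀ {i j k} → OneOrρ² i j k → fromIJK {7+ b} i j k ≡ 1ρ ⊎ fromIJK {7+ b} i j k ≡ gen ⊗ gen
  OneOrρ²⇒ (inj₁ (refl , refl , refl)) = inj₁ (decide []
    (tri (num 1 :+ num 0 :+ num 0 :* (a̲ :+ num 2)) (num 0 :+ num 0 :* a̲) (:- num 0)) 1̲ refl)
  OneOrρ²⇒ (inj₂ (refl , refl , refl)) = inj₂ (decide []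
    (tri (num 2 :+ a̲ :+ -1̲ :* (a̲ :+ num 2)) (a̲ :+ -1̲ :* a̲) (:- -1̲)) (ρ̲ ⊠ ρ̲) refl)

  small-units : ∀ ε → SmallUnit ε → ε ≡ 1ρ ⊎ ε ≡ gen ⊗ gen
  small-units ε h =
    let i , j , k , ε≡ = ijk-coordinates ε
    in subst (λ α → α ≡ 1ρ ⊎ α ≡ gen ⊗ gen) (sym ε≡) (OneOrρ²⇒ (classify {i} {j} {k} (subst SmallUnit ε≡ h)))

open import Data.Integer using (+_; _≤_)

lemma3p1 : (a : ℤ) → + 7 ≤ a → (R : Roots a) → let open Conjugates R in
    (ε : ℤ[ρ] a) → TotallyPositive ε → IsUnit ε → γ a ⪰ ε → ε ≡ 1ρ ⊎ ε ≡ gen ⊗ gen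
-- Matching on 7 ≤ a turns a into 7 + b, the form in which all certificates are stated.
lemma3p1 (+ _) (ℤ.+≤+ (s≤s (s≤s (s≤s (s≤s (s≤s (s≤s (s≤s (z≤n {b}))))))))) R ε ε>0 unit γ⪰ε =
  small-units b R ε (smallUnit b R ε ε>0 unit γ⪰ε)
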